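{- Let $\mathcal A$ be a finite alphabet, let $\varphi:\mathcal A^*\to\mathcal A^*$ be a primitive marked morphism, and let ${\bf u}\in\mathcal A^{\mathbb N}$ be a fixed point of $\varphi$ with $D({\bf u})<+\infty$. If all complete return words to all letters in ${\bf u}$ are palindromes, or if there exists a conjugate of $\varphi$ distinct from $\varphi$ itself, then $D({\bf u})=0$.
   Context: For a finite word $w$, $\widetilde w$ denotes its reversal; $w$ is a palindrome if $w=\widetilde w$. The palindromic defect of a finite word $w$ of length $n$ is $D(w)=n+1-(\text{number of distinct palindromic factors of } w$, the empty word included$)$. For an infinite word ${\bf u}$, $D({\bf u})=\sup\{D(w): w \text{ a factor of } {\bf u}\}$. A morphism $\varphi$ is primitive if there is $k$ such that every letter $b$ occurs in $\varphi^k(a)$ for every letter $a$. A fixed point of $\varphi$ is an infinite word ${\bf u}$ with $\varphi({\bf u})={\bf u}$. If $i<j$ are two consecutive occurrences of a factor $w=u_i\cdots u_{i+|w|-1}$ in ${\bf u}=u_0u_1\cdots$, then $u_iu_{i+1}\cdots u_{j+|w|-1}$ is a complete return word to $w$ in ${\bf u}$. A morphism $\psi$ is a left conjugate of $\varphi$ (and $\varphi$ a right conjugate of $\psi$), written $\psi\triangleright\varphi$, if there is $w\in\mathcal A^*$ with $\varphi(a)w=w\psi(a)$ for all $a\in\mathcal A$; a conjugate of $\varphi$ is any left or right conjugate of $\varphi$. A morphism is cyclic if there is $w$ with $\varphi(a)\in w^*$ for all letters $a$, and acyclic otherwise. For an acyclic morphism $\varphi$, its leftmost conjugate $\varphi_L$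 is the left conjugate $\psi$ of $\varphi$ for which the map $\textsc{Fst}(\psi):a\mapsto$ first letter of $\psi(a)$ is not constant, and its rightmost conjugate $\varphi_R$ is the right conjugate $\psi$ of $\varphi$ for which the map $\textsc{Lst}(\psi):a\mapsto$ last letter of $\psi(a)$ is not constant. An acyclic morphism $\varphi$ is marked if $\textsc{Fst}(\varphi_L)$ and $\textsc{Lst}(\varphi_R)$ are injective. -}

module Defs where

open import Data.Fin.Base using (Fin)
open import Data.Fin.Properties using (_≟_)
open import Data.Integer.Base as ℤ using (ℤ; +_)
open import Data.List.Base using (List; [_]; _++_; length; reverse; concat; concatMap; replicate; take; head; last; inits; tails; filter; deduplicate; applyUpTo)
open import Data.List.Membership.Propositional using (_∈_)
open import Data.List.Properties using (≡-dec)
open import Data.Maybe.Base using (Maybe)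
open import Data.Nat.Base using (ℕ; suc; _+_; _∸_; _<_)
open import Data.Nat.GeneralisedArithmetic using (fold)
open import Data.Product.Base using (∃; ∃₂; _×_)
open import Data.Sum.Base using (_⊎_)
open import Function.Definitions using (Injective)
open import Relation.Binary.Definitions using (DecidableEquality)
open import Relation.Binary.PropositionalEquality.Core using (_≡_; _≗_)
open import Relation.Nullary using (¬_)
open import Relation.Unary using (Decidable)

Word : ℕ → Set
Word n = List (Fin n)

InfWord : ℕ → Set
InfWord n = ℕ → Fin n

-- A morphism of the free monoid is given by its images of letters, so two
-- morphisms are equal exactly when they are pointwise equal (_≗_).
Morphism : ℕ → Set
Morphism n = Fin n → Word n

module _ {n : ℕ} where

  _≟ʷ_ : DecidableEquality (Word n)
  _≟ʷ_ = ≡-dec _≟_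

  Palindrome : Word n → Set
  Palindrome w = w ≡ reverse w

  palindrome? : Decidable Palindrome
  palindrome? w = w ≟ʷ reverse w

  -- With repetitions; the empty word is included.
  factors : Word n → List (Word n)
  factors w = concatMap inits (tails w)

  palindromicFactors : Word n → List (Word n)
  palindromicFactors w = deduplicate _≟ʷ_ (filter palindrome? (factors w))

  -- Integer-valued, so that the subtraction is not truncated.
  D : Word n → ℤ
  D w = + suc (length w) ℤ.- + length (palindromicFactors w)

  -- u[ i , l ] = uᵢ uᵢ₊₁ ⋯ uᵢ₊ₗ₋₁
  _[_,_] : InfWord n → ℕ → ℕ → Word n
  u [ i , l ] = applyUpTo (λ k → u (i + k)) l

  OccursAt : InfWord n → Word n → ℕ → Set
  OccursAt u w i = u [ i , length w ] ≡ w

  IsFactor : InfWord n → Word n → Set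
  IsFactor u w = ∃ λ i → OccursAt u w i

  DefectBound : InfWord n → ℤ → Set
  DefectBound u s = ∀ w → IsFactor u w → D w ℤ.≤ s

  -- D(u) < +∞
  FiniteDefect : InfWord n → Set
  FiniteDefect u = ∃ λ s → DefectBound u s

  -- D(u) = s, that is, s is the supremum of D over the factors of u
  DefectIs : InfWord n → ℤ → Set
  DefectIs u s = DefectBound u s × (∀ t → DefectBound u t → s ℤ.≤ t)

  CompleteReturnWord : InfWord n → Word n → Word n → Set
  CompleteReturnWord u w r =
    ∃₂ λ i j → i < j
             × OccursAt u w i
             × OccursAt u w j
             × (∀ k → i < k → k < j → ¬ OccursAt u w k)
             × r ≡ u [ i , (j ∸ i) + length w ]

  infix 9 _⋆_

  _⋆_ : Morphism n → Word n → Word n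
  φ ⋆ w = concatMap φ w

  -- φ(u) = v: every prefix of v is a prefix of φ(p) for some prefix p of u.
  -- In particular φ(u) is required to be infinite.
  ImageIs : Morphism n → InfWord n → InfWord n → Set
  ImageIs φ u v = ∀ m → ∃ λ l → take m (φ ⋆ (u [ 0 , l ])) ≡ v [ 0 , m ]

  FixedPoint : Morphism n → InfWord n → Set
  FixedPoint φ u = ImageIs φ u u

  -- The exponent 0 only matters over alphabets with at most one letter, where
  -- every morphism is cyclic.
  Primitive : Morphism n → Set
  Primitive φ = ∃ λ k → ∀ a b → b ∈ fold [ a ] (φ ⋆_) k

  infix 4 _▷_

  _▷_ : Morphism n → Morphism n → Set
  ψ ▷ φ = ∃ λ w → ∀ a → φ a ++ w ≡ w ++ ψ a

  Conjugate : Morphism n → Morphism n → Set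
  Conjugate ψ φ = (ψ ▷ φ) ⊎ (φ ▷ ψ)

  Cyclic : Morphism n → Set
  Cyclic φ = ∃ λ w → ∀ a → ∃ λ k → φ a ≡ concat (replicate k w)

  Acyclic : Morphism n → Set
  Acyclic φ = ¬ Cyclic φ

  -- The value is nothing only on letters with empty image; a primitive acyclic
  -- morphism has none, and neither do its conjugates.
  Fst Lst : Morphism n → Fin n → Maybe (Fin n)
  Fst ψ a = head (ψ a)
  Lst ψ a = last (ψ a)

  Constant : (Fin n → Maybe (Fin n)) → Set
  Constant f = ∀ a b → f a ≡ f b

  -- ψ = φ_L
  LeftmostConjugate : Morphism n → Morphism n → Set
  LeftmostConjugate ψ φ = (ψ ▷ φ) × ¬ Constant (Fst ψ)

  -- ψ = φ_R
  RightmostConjugate : Morphism n → Morphism n → Set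
  RightmostConjugate ψ φ = (φ ▷ ψ) × ¬ Constant (Lst ψ)

  -- φ_L and φ_R are unique for φ acyclic without empty images, so quantifying
  -- over them existentially amounts to naming them.
  Marked : Morphism n → Set
  Marked φ = Acyclic φ
           × (∃ λ φL → LeftmostConjugate φL φ × Injective _≡_ _≡_ (Fst φL))
           × (∃ λ φR → RightmostConjugate φR φ × Injective _≡_ _≡_ (Lst φR))

  LetterReturnsPalindromic : InfWord n → Set
  LetterReturnsPalindromic u = ∀ a r → CompleteReturnWord u [ a ] r → Palindrome r

  HasDistinctConjugate : Morphism n → Set
  HasDistinctConjugate φ = ∃ λ ψ → Conjugate ψ φ × ¬ (ψ ≗ φ)

{-# OPTIONS --safe #-}
module Submission where

-- Among all complete mirror returns (factors that begin and end with a word x or its mirror image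
-- and contain neither in between) a shortest non-palindromic one reads c z a ⋯ b z̃ c with a ≠ b.
-- Inside it all returns to z are palindromic, so consecutive occurrences of z and z̃ trace a path
-- from a to b avoiding c in the extension graph of z, that is, together with c, a cycle. The map
-- z ↦ φ_R(z) R, where φ_R(x) R = R φ_L(x) for all x, sends occurrences y z y′ to occurrences
-- g(y) (φ_R(z) R) f(y′); for a power of φ the permutations f = Fst φ_L and g = Lst φ_R become trivial,
-- so that the cycle is carried to extension graphs of arbitrarily long words. Finite defect makes all
-- mirror returns to long words palindromic, and then the extension graphs of long words are acyclic.
-- The empty z needs R ≠ ε, unless the returns to letters are palindromes by hypothesis.

open import Algebra.Properties.CommutativeSemigroup using (interchange)
open import Data.Bool.Base using (Bool; true; false; T; if_then_else_)
open import Data.Empty using (⊥; ⊥-elim)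
open import Data.Fin.Base as Fin using (Fin; toℕ)
open import Data.Fin.Properties using (pigeonhole; toℕ-injective) renaming (_≟_ to _≟ᶠ_)
import Data.Integer.Base as ℤ
import Data.Integer.Properties as ℤ
open import Data.List.Base using (List; []; _∷_; _++_; _∷ʳ_; length; reverse; applyUpTo; inits; filter; take; head; last; initLast; _∷ʳ′_; concat; replicate)
open import Data.List.Membership.Propositional using (_∈_; find)
open import Data.List.Membership.Propositional.Properties
open import Data.List.Properties
open import Data.List.Relation.Unary.All as All using (All)
open import Data.List.Relation.Unary.All.Properties.Core using (¬All⇒Any¬; ¬Any⇒All¬)
open import Data.List.Relation.Unary.AllPairs using ([]; _∷_)
open import Data.List.Relation.Unary.Any using (here; there)
open import Data.List.Relation.Unary.Unique.Propositional using (Unique)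
open import Data.Maybe.Base using (just)
open import Data.Nat.Base
open import Data.Nat.GeneralisedArithmetic using (fold)
open import Data.Nat.Properties
open import Data.Product.Base using (_×_; _,_; proj₁; proj₂; ∃; ∃₂)
open import Data.Sum.Base using (_⊎_; inj₁; inj₂; [_,_]′)
open import Data.Unit.Base using (tt)
open import Data.Vec.N-ary using (N-ary)
open import Function.Definitions using (Injective)
open import Relation.Binary.Construct.Closure.ReflexiveTransitive using (Star; ε; _◅_; _◅◅_; gmap)
open import Relation.Binary.Definitions using (tri<; tri≈; tri>)
open import Relation.Binary.PropositionalEquality hiding ([_])
open import Relation.Nullary
open import Relation.Nullary.Decidable using (_⊎-dec_; decidable-stable)
open import Relation.Unary using (Decidable)
open import Defs

-- Returns are taken up to mirror image because reflection in a palindromic return turns occurrences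
-- of a word into occurrences of its reversal. Finite defect enters through a factor of maximal
-- defect: it recurs with bounded gaps, so a letter prepended to any long window must create a new
-- palindrome; this makes the returns to long words palindromic and u closed under reversal.
-- Acyclicity for a long z rests on an invariant: seen from an occurrence of yz or zy, the letter
-- standing just before the next C = cz or its mirror image. Palindromic returns make it independent
-- of the occurrence, adjacent vertices share it, and at the neighbours za and zb of C it is a and
-- b. The obstacle in carrying a cycle to longer words is that the lift of a palindrome z need not
-- be a palindrome: the edges joining yz to zy are then lost, and the path is rebuilt in a double
-- cover. Constructively, a factor of maximal defect exists only up to double negation; this
-- suffices because richness of a given factor is decidable.

module LinearArithmetic where

  -- An inequality between linear expressions over ℕ is verified by comparing coefficients; lin reduces
  -- its goal to such an inequality by adding a sum of hypotheses crosswise.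

  infixl 6 _⊞_

  data Expr : Set where
    atom lit : ℕ → Expr
    _⊞_ : Expr → Expr → Expr

  infix 4 _≼_
  _≼_ : Expr → Expr → Expr × Expr
  e ≼ f = e , f

  nth : List ℕ → ℕ → ℕ
  nth [] _ = 0
  nth (x ∷ xs) zero = x
  nth (x ∷ xs) (suc i) = nth xs i

  ⟦_⟧ : Expr → List ℕ → ℕ
  ⟦ atom i ⟧ ρ = nth ρ i
  ⟦ lit k ⟧ ρ = k
  ⟦ e ⊞ f ⟧ ρ = ⟦ e ⟧ ρ + ⟦ f ⟧ ρ

  linear : List ℕ → List ℕ → ℕ
  linear [] ρ = 0
  linear (c ∷ cs) [] = 0
  linear (c ∷ cs) (x ∷ ρ) = c * x + linear cs ρ

  add : List ℕ → List ℕ → List ℕ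
  add [] ds = ds
  add (c ∷ cs) [] = c ∷ cs
  add (c ∷ cs) (d ∷ ds) = c + d ∷ add cs ds

  unit : ℕ → List ℕ
  unit zero = 1 ∷ []
  unit (suc i) = 0 ∷ unit i

  linear-add : ∀ cs ds ρ → linear (add cs ds) ρ ≡ linear cs ρ + linear ds ρ
  linear-add [] ds ρ = refl
  linear-add (c ∷ cs) [] ρ = sym (+-identityʳ _)
  linear-add (c ∷ cs) (d ∷ ds) [] = refl
  linear-add (c ∷ cs) (d ∷ ds) (x ∷ ρ) =
    trans (cong₂ _+_ (*-distribʳ-+ x c d) (linear-add cs ds ρ)) (interchange +-commutativeSemigroup (c * x) (d * x) (linear cs ρ) (linear ds ρ))

  linear-unit : ∀ i ρ → linear (unit i) ρ ≡ nth ρ i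
  linear-unit zero [] = refl
  linear-unit zero (x ∷ ρ) = trans (+-identityʳ _) (*-identityˡ x)
  linear-unit (suc i) [] = refl
  linear-unit (suc i) (x ∷ ρ) = linear-unit i ρ

  -- The constant term is the coefficient of one extra variable, put in front and given the value 1.
  norm : Expr → List ℕ
  norm (atom i) = 0 ∷ unit i
  norm (lit k) = k ∷ []
  norm (e ⊞ f) = add (norm e) (norm f)

  norm-sound : ∀ e ρ → ⟦ e ⟧ ρ ≡ linear (norm e) (1 ∷ ρ)
  norm-sound (atom i) ρ = sym (linear-unit i ρ)
  norm-sound (lit k) ρ = sym (trans (+-identityʳ _) (*-identityʳ k))
  norm-sound (e ⊞ f) ρ =
      trans (cong₂ _+_ (norm-sound e ρ) (norm-sound f ρ)) (sym (linear-add (norm e) (norm f) (1 ∷ ρ)))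

  _⊴_ : List ℕ → List ℕ → Bool
  [] ⊴ _ = true
  (c ∷ cs) ⊴ (d ∷ ds) = if c ≤ᵇ d then cs ⊴ ds else false
  (zero ∷ cs) ⊴ [] = cs ⊴ []
  (suc _ ∷ cs) ⊴ [] = false

  ⊴-sound : ∀ cs ds ρ → T (cs ⊴ ds) → linear cs ρ ≤ linear ds ρ
  ⊴-sound [] ds ρ t = z≤n
  ⊴-sound (c ∷ cs) ds [] t = z≤n
  ⊴-sound (zero ∷ cs) [] (x ∷ ρ) t = ⊴-sound cs [] ρ t
  ⊴-sound (c ∷ cs) (d ∷ ds) (x ∷ ρ) t with c ≤ᵇ d in eq
  ... | true = +-mono-≤ (*-monoˡ-≤ x (≤ᵇ⇒≤ c d (subst T (sym eq) tt))) (⊴-sound cs ds ρ t)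

  apply-atoms : ∀ {A : Set} k → N-ary k Expr A → ℕ → A
  apply-atoms zero f i = f
  apply-atoms (suc k) f i = apply-atoms k (f (atom i)) (suc i)

  sides : (ρ : List ℕ) → N-ary (length ρ) Expr (Expr × Expr) → Expr × Expr
  sides ρ f = apply-atoms (length ρ) f 0

  ≤-solve : ∀ ρ (f : N-ary (length ρ) Expr (Expr × Expr)) →
            let (e , e′) = sides ρ f in {_ : T (norm e ⊴ norm e′)} → ⟦ e ⟧ ρ ≤ ⟦ e′ ⟧ ρ
  ≤-solve ρ f {t} = let (e , e′) = sides ρ f in
    subst₂ _≤_ (sym (norm-sound e ρ)) (sym (norm-sound e′ ρ)) (⊴-sound (norm e) (norm e′) (1 ∷ ρ) t)

  ≡-solve : ∀ ρ (f : N-ary (length ρ) Expr (Expr × Expr)) →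
            let (e , e′) = sides ρ f in {_ : T (norm e ⊴ norm e′)} → {_ : T (norm e′ ⊴ norm e)} → ⟦ e ⟧ ρ ≡ ⟦ e′ ⟧ ρ
  ≡-solve ρ f {t} {t′} = ≤-antisym (≤-solve ρ f {t})
    (let (e , e′) = sides ρ f in
     subst₂ _≤_ (sym (norm-sound e′ ρ)) (sym (norm-sound e ρ)) (⊴-sound (norm e′) (norm e) (1 ∷ ρ) t′))

  lin : ∀ {a b x y} → a ≤ b → x + b ≤ y + a → x ≤ y
  lin {a} {b} {x} {y} h e = +-cancelʳ-≤ b x y (≤-trans e (+-monoʳ-≤ y h))

  lin⊥ : ∀ {a b} → a ≤ b → suc b ≤ a → ⊥
  lin⊥ h e = 1+n≰n (≤-trans e h)

  infixr 5 _⊕_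
  _⊕_ : ∀ {a b c d} → a ≤ b → c ≤ d → a + c ≤ b + d
  _⊕_ = +-mono-≤

  ≡⇒≤ : ∀ {a b} → a ≡ b → a ≤ b
  ≡⇒≤ = ≤-reflexive

  ≡⇒≥ : ∀ {a b} → a ≡ b → b ≤ a
  ≡⇒≥ e = ≤-reflexive (sym e)

  lin≡ : ∀ {a b x y} → a ≡ b → x + b ≡ y + a → x ≡ y
  lin≡ {b = b} {x} {y} refl e = +-cancelʳ-≡ b x y e

  infixr 5 _⊕≡_
  _⊕≡_ : ∀ {a b c d : ℕ} → a ≡ b → c ≡ d → a + c ≡ b + d
  _⊕≡_ = cong₂ _+_

open LinearArithmetic using (lit; _⊞_; _≼_; ≤-solve; ≡-solve; lin; lin⊥; lin≡; _⊕_; _⊕≡_; ≡⇒≤; ≡⇒≥)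

-- Windows of an infinite word, reflections and mirror returns.

++-injective : ∀ {A : Set} (a b : List A) {c d} → length a ≡ length b → a ++ c ≡ b ++ d → a ≡ b × c ≡ d
++-injective [] [] _ e = refl , e
++-injective (x ∷ a) (y ∷ b) l e with ∷-injective e
... | refl , e′ with ++-injective a b (suc-injective l) e′
... | refl , e″ = refl , e″

applyUpTo-cong : ∀ {A : Set} {f g : ℕ → A} → f ≗ g → ∀ l → applyUpTo f l ≡ applyUpTo g l
applyUpTo-cong e zero = refl
applyUpTo-cong e (suc l) = cong₂ _∷_ (e 0) (applyUpTo-cong (λ k → e (suc k)) l)

module Windows {n : ℕ} (u : InfWord n) where

  win-∷ : ∀ i l → u [ i , suc l ] ≡ u i ∷ u [ suc i , l ]
  win-∷ i l = cong₂ _∷_ (cong u (+-identityʳ i)) (applyUpTo-cong (λ k → cong u (+-suc i k)) l)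

  win-∷ʳ : ∀ i l → u [ i , suc l ] ≡ u [ i , l ] ∷ʳ u (i + l)
  win-∷ʳ i l = sym (applyUpTo-∷ʳ (λ k → u (i + k)) l)

  length-win : ∀ i l → length (u [ i , l ]) ≡ l
  length-win i l = length-applyUpTo _ l

  win-++ : ∀ i l m → u [ i , l + m ] ≡ u [ i , l ] ++ u [ i + l , m ]
  win-++ i zero m = cong (λ j → u [ j , m ]) (sym (+-identityʳ i))
  win-++ i (suc l) m = begin
    u [ i , suc l + m ]                              ≡⟨ win-∷ i (l + m) ⟩
    u i ∷ u [ suc i , l + m ]                        ≡⟨ cong (u i ∷_) (win-++ (suc i) l m) ⟩
    u i ∷ (u [ suc i , l ] ++ u [ suc i + l , m ])   ≡⟨ cong₂ _++_ (sym (win-∷ i l)) (cong (λ j → u [ j , m ]) (sym (+-suc i l))) ⟩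
    u [ i , suc l ] ++ u [ i + suc l , m ]           ∎
    where open ≡-Reasoning

  occ-win : ∀ i l → OccursAt u (u [ i , l ]) i
  occ-win i l = cong (λ k → u [ i , k ]) (length-win i l)

  occ-++⁻ : ∀ v w {i} → OccursAt u (v ++ w) i → OccursAt u v i × OccursAt u w (i + length v)
  occ-++⁻ v w {i} o = ++-injective _ v (length-win i (length v))
    (trans (sym (win-++ i (length v) (length w))) (trans (cong (λ k → u [ i , k ]) (sym (length-++ v))) o))

  occ-++⁺ : ∀ v w {i} → OccursAt u v i → OccursAt u w (i + length v) → OccursAt u (v ++ w) i
  occ-++⁺ v w {i} p q = trans (cong (λ k → u [ i , k ]) (length-++ v))
    (trans (win-++ i (length v) (length w)) (cong₂ _++_ p q))

  occ-letter : ∀ i → OccursAt u (u i ∷ []) i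
  occ-letter i = cong (_∷ []) (cong u (+-identityʳ i))

  occ-∷⁻ : ∀ a w {i} → OccursAt u (a ∷ w) i → u i ≡ a × OccursAt u w (suc i)
  occ-∷⁻ a w {i} o = ∷-injective (trans (sym (win-∷ i (length w))) o)

  occ-∷⁺ : ∀ w {i} → OccursAt u w (suc i) → OccursAt u (u i ∷ w) i
  occ-∷⁺ w {i} o = trans (win-∷ i (length w)) (cong (u i ∷_) o)

  occ-∷ʳ⁺ : ∀ w {i} → OccursAt u w i → OccursAt u (w ∷ʳ u (i + length w)) i
  occ-∷ʳ⁺ w {i} o = occ-++⁺ w _ o (occ-letter (i + length w))

  occ-∷ʳ⁻ : ∀ a w {i} → OccursAt u (w ∷ʳ a) i → OccursAt u w i × u (i + length w) ≡ a
  occ-∷ʳ⁻ a w o = let (p , q) = occ-++⁻ w (a ∷ []) o in p , proj₁ (occ-∷⁻ a [] q)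

  -- Mirror positions are described by a constant sum s + t, which avoids truncated subtraction and
  -- lets reflections be composed by linear arithmetic. The two lower bounds and the sum imply the
  -- upper bounds.
  reverse-win⁺ : ∀ m p p′ → (∀ s t → p ≤ s → p′ ≤ t → suc (s + t) ≡ p + p′ + m → u s ≡ u t) →
                 reverse (u [ p , m ]) ≡ u [ p′ , m ]
  reverse-win⁺ zero p p′ h = refl
  reverse-win⁺ (suc m) p p′ h = begin
    reverse (u [ p , suc m ])            ≡⟨ cong reverse (win-∷ p m) ⟩
    reverse (u p ∷ u [ suc p , m ])      ≡⟨ unfold-reverse (u p) (u [ suc p , m ]) ⟩
    reverse (u [ suc p , m ]) ∷ʳ u p     ≡⟨ cong₂ _∷ʳ_
      (reverse-win⁺ m (suc p) p′ (λ s t a b e → h s t (<⇒≤ a) b (lin≡ e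
          (≡-solve (s ∷ t ∷ p ∷ p′ ∷ m ∷ []) λ s t p p′ m → lit 1 ⊞ (s ⊞ t) ⊞ (lit 1 ⊞ p ⊞ p′ ⊞ m) ≼
          p ⊞ p′ ⊞ (lit 1 ⊞ m) ⊞ (lit 1 ⊞ (s ⊞ t))))))
      (h p (p′ + m) ≤-refl (m≤m+n p′ m)
          (≡-solve (p ∷ p′ ∷ m ∷ []) λ p p′ m → lit 1 ⊞ (p ⊞ (p′ ⊞ m)) ≼ p ⊞ p′ ⊞ (lit 1 ⊞ m))) ⟩
    u [ p′ , m ] ∷ʳ u (p′ + m)           ≡⟨ sym (win-∷ʳ p′ m) ⟩
    u [ p′ , suc m ]                     ∎
    where open ≡-Reasoning

  reverse-win⁻ : ∀ m p p′ → reverse (u [ p , m ]) ≡ u [ p′ , m ] →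
                 ∀ s t → p ≤ s → p′ ≤ t → suc (s + t) ≡ p + p′ + m → u s ≡ u t
  reverse-win⁻ zero p p′ e s t a b c = ⊥-elim (lin⊥ (a ⊕ b ⊕ ≡⇒≤ c)
      (≤-solve (s ∷ t ∷ p ∷ p′ ∷ []) λ s t p p′ → lit 1 ⊞ (s ⊞ (t ⊞ (p ⊞ p′ ⊞ lit 0))) ≼
      p ⊞ (p′ ⊞ (lit 1 ⊞ (s ⊞ t)))))
  reverse-win⁻ (suc m) p p′ e s t a b c with ∷ʳ-injective (reverse (u [ suc p , m ])) (u [ p′ , m ])
     (trans (sym (unfold-reverse (u p) (u [ suc p , m ]))) (trans (cong reverse (sym (win-∷ p m))) (trans e (win-∷ʳ p′ m))))
  ... | e₁ , e₂ with m≤n⇒m<n∨m≡n a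
  ... | inj₁ a′ = reverse-win⁻ m (suc p) p′ e₁ s t a′ b (lin≡ c
      (≡-solve (s ∷ t ∷ p ∷ p′ ∷ m ∷ []) λ s t p p′ m → lit 1 ⊞ (s ⊞ t) ⊞ (p ⊞ p′ ⊞ (lit 1 ⊞ m)) ≼
      lit 1 ⊞ p ⊞ p′ ⊞ m ⊞ (lit 1 ⊞ (s ⊞ t))))
  ... | inj₂ refl = trans e₂ (cong u (lin≡ (sym c)
      (≡-solve (p′ ∷ m ∷ p ∷ t ∷ []) λ p′ m p t → p′ ⊞ m ⊞ (lit 1 ⊞ (p ⊞ t)) ≼ t ⊞ (p ⊞ p′ ⊞ (lit 1 ⊞ m)))))

  -- The factor of u on the half-open interval [i, e) is a palindrome.
  PalSegment : ℕ → ℕ → Set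
  PalSegment i e = ∀ s t → i ≤ s → i ≤ t → suc (s + t) ≡ i + e → u s ≡ u t

  palSegment⁺ : ∀ i l → Palindrome (u [ i , l ]) → PalSegment i (i + l)
  palSegment⁺ i l p s t a b e = reverse-win⁻ l i i (sym p) s t a b (lin≡ e
      (≡-solve (s ∷ t ∷ i ∷ l ∷ []) λ s t i l → lit 1 ⊞ (s ⊞ t) ⊞ (i ⊞ (i ⊞ l)) ≼
      i ⊞ i ⊞ l ⊞ (lit 1 ⊞ (s ⊞ t))))

  palSegment⁻ : ∀ i l → PalSegment i (i + l) → Palindrome (u [ i , l ])
  palSegment⁻ i l h = sym (reverse-win⁺ l i i (λ s t a b e → h s t a b (lin≡ e
      (≡-solve (s ∷ t ∷ i ∷ l ∷ []) λ s t i l → lit 1 ⊞ (s ⊞ t) ⊞ (i ⊞ i ⊞ l) ≼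
      i ⊞ (i ⊞ l) ⊞ (lit 1 ⊞ (s ⊞ t))))))

  palSegment-letter : ∀ i → PalSegment i (i + 1)
  palSegment-letter i s t a b e = cong u (trans (≤-antisym s≤i a) (≤-antisym b t≤i))
    where
    s≤i : s ≤ i
    s≤i = lin (b ⊕ ≡⇒≤ e)
        (≤-solve (s ∷ t ∷ i ∷ []) λ s t i → s ⊞ (t ⊞ (i ⊞ (i ⊞ lit 1))) ≼ i ⊞ (i ⊞ (lit 1 ⊞ (s ⊞ t))))
    t≤i : t ≤ i
    t≤i = lin (a ⊕ ≡⇒≤ e)
        (≤-solve (t ∷ s ∷ i ∷ []) λ t s i → t ⊞ (s ⊞ (i ⊞ (i ⊞ lit 1))) ≼ i ⊞ (i ⊞ (lit 1 ⊞ (s ⊞ t))))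

  palSegment? : ∀ i l → Dec (PalSegment i (i + l))
  palSegment? i l with palindrome? (u [ i , l ])
  ... | yes p = yes (palSegment⁺ i l p)
  ... | no ¬p = no (λ h → ¬p (palSegment⁻ i l h))

  occ-reflect : ∀ x {i e p p′} → PalSegment i e → p + p′ + length x ≡ i + e → i ≤ p → i ≤ p′ →
                OccursAt u x p → OccursAt u (reverse x) p′
  occ-reflect x {i} {e} {p} {p′} h c a b o = begin
    u [ p′ , length (reverse x) ] ≡⟨ cong (λ k → u [ p′ , k ]) (length-reverse x) ⟩
    u [ p′ , length x ]           ≡⟨ sym (reverse-win⁺ (length x) p p′
      (λ s t a′ b′ c′ → h s t (≤-trans a a′) (≤-trans b b′) (trans c′ c))) ⟩
    reverse (u [ p , length x ])  ≡⟨ cong reverse o ⟩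
    reverse x                     ∎
    where open ≡-Reasoning

  MirrorOcc : Word n → ℕ → Set
  MirrorOcc x p = OccursAt u x p ⊎ OccursAt u (reverse x) p

  mirrorOcc? : ∀ x p → Dec (MirrorOcc x p)
  mirrorOcc? x p = (_ ≟ʷ _) ⊎-dec (_ ≟ʷ _)

  mirrorOcc-reflect : ∀ x {i e p p′} → PalSegment i e → p + p′ + length x ≡ i + e → i ≤ p → i ≤ p′ →
                      MirrorOcc x p → MirrorOcc x p′
  mirrorOcc-reflect x h c a b (inj₁ o) = inj₂ (occ-reflect x h c a b o)
  mirrorOcc-reflect x {i} {e} {p} {p′} h c a b (inj₂ o) =
    inj₁ (subst (λ y → OccursAt u y p′) (reverse-involutive x)
      (occ-reflect (reverse x) h (trans (cong (p + p′ +_) (length-reverse x)) c) a b o))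

  -- Only the occurrences of x and of its mirror image together form a class that is stable under
  -- reflection in palindromic segments. For a palindrome x these are the ordinary complete returns.
  record MirrorReturn (x : Word n) (i j : ℕ) : Set where
    constructor mirrorReturn
    field
      i<j   : i < j
      start : MirrorOcc x i
      end   : MirrorOcc x j
      inner : ∀ k → i < k → k < j → ¬ MirrorOcc x k

  PalReturns : Word n → Set
  PalReturns x = ∀ i j → MirrorReturn x i j → PalSegment i (j + length x)

  mirrorReturn-reverse : ∀ x {i j} → MirrorReturn x i j → MirrorReturn (reverse x) i j
  mirrorReturn-reverse x (mirrorReturn a b c d) = mirrorReturn a (flip b) (flip c)
    (λ k p q → λ { (inj₁ o) → d k p q (inj₂ o) ; (inj₂ o) → d k p q (inj₁ (subst (λ y → OccursAt u y k) (reverse-involutive x) o)) })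
    where
    flip : ∀ {k} → MirrorOcc x k → MirrorOcc (reverse x) k
    flip (inj₁ o) = inj₂ (subst (λ y → OccursAt u y _) (sym (reverse-involutive x)) o)
    flip (inj₂ o) = inj₁ o

-- Counting palindromic factors.

length-⊆ : ∀ {A : Set} {xs ys : List A} → Unique xs → (∀ {x} → x ∈ xs → x ∈ ys) → length xs ≤ length ys
length-⊆ [] _ = z≤n
length-⊆ {xs = x ∷ xs} (x∉ ∷ xs!) sub with ∈-∃++ (sub (here refl))
... | as , bs , refl = ≤-trans (s≤s (length-⊆ xs! sub′)) (≤-reflexive (sym
      (trans (length-++ as) (trans (+-suc (length as) (length bs)) (cong suc (sym (length-++ as)))))))
  where
  sub′ : ∀ {y} → y ∈ xs → y ∈ as ++ bs
  sub′ y∈ with ∈-++⁻ as (sub (there y∈))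
  ... | inj₁ p = ∈-++⁺ˡ p
  ... | inj₂ (here refl) = ⊥-elim (All.lookup x∉ y∈ refl)
  ... | inj₂ (there p) = ∈-++⁺ʳ as p

Infix : ∀ {A : Set} → List A → List A → Set
Infix q w = ∃₂ λ v v′ → w ≡ v ++ q ++ v′

module _ {A : Set} where

  ∈-inits⁻ : ∀ (w : List A) {q} → q ∈ inits w → ∃ λ v → w ≡ q ++ v
  ∈-inits⁻ w (here refl) = w , refl
  ∈-inits⁻ (a ∷ w) (there (here refl)) = w , refl
  ∈-inits⁻ (a ∷ w) (there (there q∈)) with ∈-map⁻ (a ∷_) q∈
  ... | q , p , refl with ∈-inits⁻ w (there p)
  ... | v , refl = v , refl

  ∈-inits⁺ : ∀ (q v : List A) → q ∈ inits (q ++ v)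
  ∈-inits⁺ [] v = here refl
  ∈-inits⁺ (a ∷ []) v = there (here refl)
  ∈-inits⁺ (a ∷ q@(_ ∷ _)) v with ∈-inits⁺ q v
  ... | there p = there (there (∈-map⁺ (a ∷_) p))

  prefix-compare : ∀ (q q′ : List A) {s s′} → q ++ s ≡ q′ ++ s′ →
                   (∃ λ t → q′ ≡ q ++ t) ⊎ (∃ λ t → q ≡ q′ ++ t)
  prefix-compare [] q′ e = inj₁ (q′ , refl)
  prefix-compare (a ∷ q) [] e = inj₂ (a ∷ q , refl)
  prefix-compare (a ∷ q) (b ∷ q′) e with ∷-injective e
  ... | refl , e′ with prefix-compare q q′ e′
  ... | inj₁ (t , refl) = inj₁ (t , refl)
  ... | inj₂ (t , refl) = inj₂ (t , refl)

module _ {n : ℕ} where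

  ∈-factors⁻ : ∀ (w : Word n) {q} → q ∈ factors w → Infix q w
  ∈-factors⁻ [] (here refl) = [] , [] , refl
  ∈-factors⁻ (a ∷ w) q∈ with ∈-++⁻ (inits (a ∷ w)) q∈
  ... | inj₁ p = let (v , e) = ∈-inits⁻ (a ∷ w) p in [] , v , e
  ... | inj₂ p with ∈-factors⁻ w p
  ... | v , v′ , refl = a ∷ v , v′ , refl

  ∈-factors⁺ : ∀ (v q v′ : Word n) → q ∈ factors (v ++ q ++ v′)
  ∈-factors⁺ [] [] [] = here refl
  ∈-factors⁺ [] [] (a ∷ v′) = here refl
  ∈-factors⁺ [] (a ∷ q) v′ = ∈-++⁺ˡ (∈-inits⁺ (a ∷ q) v′)
  ∈-factors⁺ (a ∷ v) q v′ = ∈-++⁺ʳ (inits (a ∷ v ++ q ++ v′)) (∈-factors⁺ v q v′)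

  PalInfix : Word n → Word n → Set
  PalInfix q w = Infix q w × Palindrome q

  ∈-pal⁻ : ∀ w {q} → q ∈ palindromicFactors w → PalInfix q w
  ∈-pal⁻ w q∈ with ∈-filter⁻ palindrome? {xs =
      factors w} (∈-deduplicate⁻ _≟ʷ_ (filter palindrome? (factors w)) q∈)
  ... | f , p = ∈-factors⁻ w f , p

  ∈-pal⁺ : ∀ w {q} → PalInfix q w → q ∈ palindromicFactors w
  ∈-pal⁺ w {q} ((v , v′ , refl) , p) = ∈-deduplicate⁺ _≟ʷ_ (∈-filter⁺ palindrome? (∈-factors⁺ v q v′) p)

  open import Data.List.Membership.DecPropositional (_≟ʷ_ {n}) using (_∈?_)
  open import Data.List.Relation.Unary.Unique.DecPropositional.Properties (_≟ʷ_ {n}) using (deduplicate-!)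

  pal-unique : ∀ w → Unique (palindromicFactors w)
  pal-unique w = deduplicate-! (filter palindrome? (factors w))

  opaque
    palCount : Word n → ℕ
    palCount w = length (palindromicFactors w)

    palCount-mono : ∀ w w′ → (∀ {q} → PalInfix q w → PalInfix q w′) → palCount w ≤ palCount w′
    palCount-mono w w′ h = length-⊆ (pal-unique w) (λ q∈ → ∈-pal⁺ w′ (h (∈-pal⁻ w q∈)))

    palCount-def : ∀ w → palCount w ≡ length (palindromicFactors w)
    palCount-def w = refl

    palCount-[] : palCount [] ≡ 1
    palCount-[] = refl

  palCount-reverse : ∀ w → palCount (reverse w) ≤ palCount w
  palCount-reverse w = palCount-mono (reverse w) w λ { {q} ((v , v′ , e) , p) →
    (reverse v′ , reverse v , (begin
      w                                        ≡⟨ sym (reverse-involutive w) ⟩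
      reverse (reverse w)                      ≡⟨ cong reverse e ⟩
      reverse (v ++ q ++ v′)                   ≡⟨ reverse-++ v (q ++ v′) ⟩
      reverse (q ++ v′) ++ reverse v           ≡⟨ cong (_++ reverse v) (reverse-++ q v′) ⟩
      (reverse v′ ++ reverse q) ++ reverse v   ≡⟨ cong (λ t → (reverse v′ ++ t) ++ reverse v) (sym p) ⟩
      (reverse v′ ++ q) ++ reverse v           ≡⟨ ++-assoc (reverse v′) q (reverse v) ⟩
      reverse v′ ++ q ++ reverse v             ∎)) , p }
    where open ≡-Reasoning

  NewPalPrefix : Fin n → Word n → Word n → Set
  NewPalPrefix a w q = (∃ λ s → a ∷ w ≡ q ++ s) × Palindrome q × ¬ Infix q w

  infix-∷⁻ : ∀ {a : Fin n} {w q} → Infix q (a ∷ w) → (∃ λ s → a ∷ w ≡ q ++ s) ⊎ Infix q w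
  infix-∷⁻ ([] , v′ , e) = inj₁ (v′ , e)
  infix-∷⁻ (b ∷ v , v′ , refl) = inj₂ (v , v′ , refl)

  infix-∷⁺ : ∀ {a : Fin n} {w q} → Infix q w → Infix q (a ∷ w)
  infix-∷⁺ {a} (v , v′ , refl) = a ∷ v , v′ , refl

  -- Of two nested palindromic prefixes the shorter one is also a suffix of the longer one.
  shorter-not-new : ∀ (a : Fin n) (w q t : Word n) {s : Word n} → a ∷ w ≡ (q ++ t) ++ s → Palindrome q →
      Palindrome (q ++ t) →
                    ¬ Infix q w → t ≡ []
  shorter-not-new a w q [] e p p′ ¬i = refl
  shorter-not-new a w q (b ∷ t) {s} e p p′ ¬i = ⊥-elim (¬i (tail e′))
    where
    suffix : q ++ b ∷ t ≡ reverse (b ∷ t) ++ q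
    suffix = trans p′ (trans (reverse-++ q (b ∷ t)) (cong (reverse (b ∷ t) ++_) (sym p)))
    e′ : a ∷ w ≡ reverse (b ∷ t) ++ q ++ s
    e′ = trans e (trans (cong (_++ s) suffix) (++-assoc (reverse (b ∷ t)) q s))
    tail : a ∷ w ≡ reverse (b ∷ t) ++ q ++ s → Infix q w
    tail e with reverse (b ∷ t) in eq
    ... | [] with () ← trans (sym (length-reverse (b ∷ t))) (cong length eq)
    ... | c ∷ r = r , s , ∷-injectiveʳ e

  new-unique : ∀ {a : Fin n} {w q q′ : Word n} → NewPalPrefix a w q → NewPalPrefix a w q′ → q ≡ q′
  new-unique {a} {w} {q} {q′} ((s , e) , p , ¬i) ((s′ , e′) , p′ , ¬i′) with prefix-compare q q′ (trans (sym e) e′)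
  ... | inj₁ (t , refl) = sym (trans (cong (q ++_) (shorter-not-new a w q t e′ p p′ ¬i)) (++-identityʳ q))
  ... | inj₂ (t , refl) = trans (cong (q′ ++_) (shorter-not-new a w q′ t e p′ p ¬i′)) (++-identityʳ q′)

  opaque
    unfolding palCount
    new-or-old : ∀ a w → ∃ (NewPalPrefix a w) ⊎ palCount (a ∷ w) ≤ palCount w
    new-or-old a w with All.all? (_∈? palindromicFactors w) (palindromicFactors (a ∷ w))
    ... | yes all = inj₂ (length-⊆ (pal-unique (a ∷ w)) (All.lookup all))
    ... | no ¬all with find (¬All⇒Any¬ (_∈? palindromicFactors w) _ ¬all)
    ... | q , q∈ , q∉ with ∈-pal⁻ (a ∷ w) q∈
    ... | i , p with infix-∷⁻ i
    ... | inj₁ pre = inj₁ (q , pre , p , λ i′ → q∉ (∈-pal⁺ w (i′ , p)))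
    ... | inj₂ i′ = ⊥-elim (q∉ (∈-pal⁺ w (i′ , p)))

    palCount-new : ∀ {a : Fin n} {w q : Word n} → NewPalPrefix a w q → suc (palCount w) ≤ palCount (a ∷ w)
    palCount-new {a} {w} {q} ((s , e) , p , ¬i) = length-⊆
      {xs = q ∷ palindromicFactors w}
      (¬Any⇒All¬ _ (λ q∈ → ¬i (proj₁ (∈-pal⁻ w q∈))) ∷ pal-unique w)
      λ { (here refl) → ∈-pal⁺ (a ∷ w) (([] , s , e) , p)
        ; (there q∈) → let (i , p′) = ∈-pal⁻ w q∈ in ∈-pal⁺ (a ∷ w) (infix-∷⁺ i , p′) }

    -- Every palindromic factor of `a ∷ w` missing from `w` is a new prefix, and by `new-unique`
    -- there is at most one such prefix.
    palCount-∷ : ∀ a w → palCount (a ∷ w) ≤ suc (palCount w)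
    palCount-∷ a w with new-or-old a w
    ... | inj₂ c = m≤n⇒m≤1+n c
    ... | inj₁ (q , new) = length-⊆ {ys = q ∷ palindromicFactors w} (pal-unique (a ∷ w)) sub
      where
      sub : ∀ {r} → r ∈ palindromicFactors (a ∷ w) → r ∈ q ∷ palindromicFactors w
      sub {r} r∈ with r ∈? palindromicFactors w
      ... | yes r∈′ = there r∈′
      ... | no r∉ with ∈-pal⁻ (a ∷ w) r∈
      ... | i , p with infix-∷⁻ i
      ... | inj₁ pre = here (new-unique (pre , p , λ i′ → r∉ (∈-pal⁺ w (i′ , p))) new)
      ... | inj₂ i′ = ⊥-elim (r∉ (∈-pal⁺ w (i′ , p)))

  palCount-++ˡ : ∀ v w → palCount (v ++ w) ≤ length v + palCount w
  palCount-++ˡ [] w = ≤-refl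
  palCount-++ˡ (a ∷ v) w = ≤-trans (palCount-∷ a (v ++ w)) (s≤s (palCount-++ˡ v w))

  palCount-++ʳ : ∀ w v → palCount (w ++ v) ≤ length v + palCount w
  palCount-++ʳ w v = begin
    palCount (w ++ v)                                  ≡⟨ cong palCount (sym (reverse-involutive (w ++ v))) ⟩
    palCount (reverse (reverse (w ++ v)))              ≤⟨ palCount-reverse (reverse (w ++ v)) ⟩
    palCount (reverse (w ++ v))                        ≡⟨ cong palCount (reverse-++ w v) ⟩
    palCount (reverse v ++ reverse w)                  ≤⟨ palCount-++ˡ (reverse v) (reverse w) ⟩
    length (reverse v) + palCount (reverse w)          ≤⟨ +-mono-≤ (≤-reflexive (length-reverse v)) (palCount-reverse w) ⟩
    length v + palCount w                              ∎
    where open ≤-Reasoning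

  -- The defect is monotone: D w ≤ D t, written without subtraction. Each letter added on either
  -- side contributes at most one palindrome.
  palCount-infix : ∀ {w t} → Infix w t → palCount t + length w ≤ palCount w + length t
  palCount-infix {w} (v , v′ , refl) =
    lin (palCount-++ˡ v (w ++ v′) ⊕ palCount-++ʳ w v′ ⊕ ≡⇒≥ (length-++ v {w ++ v′}) ⊕ ≡⇒≥ (length-++ w {v′}))
        (≤-solve (palCount (v ++ w ++ v′) ∷ length w ∷ length v ∷ palCount (w ++ v′) ∷ length v′ ∷ palCount w ∷ length (v ++ w ++ v′) ∷ length (w ++ v′) ∷ []) λ #vwv′ |w| |v| #wv′ |v′| #w |vwv′| |wv′| → #vwv′ ⊞ |w| ⊞ (|v| ⊞ #wv′ ⊞ (|v′| ⊞ #w ⊞ (|vwv′| ⊞ |wv′|))) ≼ #w ⊞ |vwv′| ⊞ (#vwv′ ⊞ (#wv′ ⊞ (|v| ⊞ |wv′| ⊞ (|w| ⊞ |v′|)))))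

module NewPalindromes {n : ℕ} (u : InfWord n) where
  open Windows u

  infix-win⁻ : ∀ {q i L} → Infix q (u [ i , L ]) → ∃ λ j → i ≤ j × j + length q ≤ i + L × OccursAt u q j
  infix-win⁻ {q} {i} {L} (v , v′ , e) = i + length v , m≤m+n i (length v) ,
    lin (≡⇒≥ len)
        (≤-solve (i ∷ length v ∷ length q ∷ L ∷ length v′ ∷ []) λ i |v| |q| L |v′| → i ⊞ |v| ⊞ |q| ⊞ L ≼
        i ⊞ L ⊞ (|v| ⊞ (|q| ⊞ |v′|))) , proj₁ (occ-++⁻ q v′ (proj₂ (occ-++⁻ v (q ++ v′) o)))
    where
    len : L ≡ length v + (length q + length v′)
    len =
        trans (sym (length-win i L)) (trans (cong length e) (trans (length-++ v) (cong (length v +_) (length-++ q))))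
    o : OccursAt u (v ++ q ++ v′) i
    o = trans (cong (λ k → u [ i , k ]) (trans (cong length (sym e)) (length-win i L))) e

  infix-win⁺ : ∀ {q i L j} → i ≤ j → j + length q ≤ i + L → OccursAt u q j → Infix q (u [ i , L ])
  infix-win⁺ {q} {i} {L} {j} a b o with m≤n⇒∃[o]m+o≡n a
  ... | d , refl with m≤n⇒∃[o]m+o≡n {d + length q} {L} (lin b
      (≤-solve (d ∷ length q ∷ i ∷ L ∷ []) λ d |q| i L → d ⊞ |q| ⊞ (i ⊞ L) ≼ L ⊞ (i ⊞ d ⊞ |q|)))
  ... | r , refl = u [ i , d ] , u [ i + (d + length q) , r ] , (begin
    u [ i , d + length q + r ] ≡⟨ win-++ i (d + length q) r ⟩
    u [ i , d + length q ] ++ u [ i + (d + length q) , r ] ≡⟨ cong (_++ u [ i + (d + length q) , r ]) (win-++ i d (length q)) ⟩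
    (u [ i , d ] ++ u [ i + d , length q ]) ++ u [ i + (d + length q) , r ] ≡⟨ cong (λ t → (u [ i , d ] ++ t) ++ u [ i + (d + length q) , r ]) o ⟩
    (u [ i , d ] ++ q) ++ u [ i + (d + length q) , r ] ≡⟨ ++-assoc (u [ i , d ]) q _ ⟩
    u [ i , d ] ++ q ++ u [ i + (d + length q) , r ] ∎)
    where open ≡-Reasoning

  -- A palindromic prefix of the window u [ i , suc L ] that does not occur in it again.
  NewPalAt : ℕ → ℕ → Set
  NewPalAt i L = ∃ λ l → l ≤ suc L × PalSegment i (i + l) ×
    (∀ j → i < j → j + l ≤ i + suc L → ¬ OccursAt u (u [ i , l ]) j)

  newPalAt⁺ : ∀ {i L q} → NewPalPrefix (u i) (u [ suc i , L ]) q → NewPalAt i L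
  newPalAt⁺ {i} {L} {q} ((s , e) , p , ¬i) =
      length q , len , palSegment⁺ i (length q) (subst Palindrome (sym o) p) ,
    λ j a b o′ → ¬i (infix-win⁺ a (≤-trans b (≤-reflexive (+-suc i L)))
      (subst (λ t → OccursAt u t j) o o′))
    where
    e′ : u [ i , suc L ] ≡ q ++ s
    e′ = trans (win-∷ i L) e
    len≡ : suc L ≡ length q + length s
    len≡ = trans (sym (length-win i (suc L))) (trans (cong length e′) (length-++ q))
    len : length q ≤ suc L
    len = lin (≡⇒≥ len≡)
        (≤-solve (length q ∷ L ∷ length s ∷ []) λ |q| L |s| → |q| ⊞ (lit 1 ⊞ L) ≼ lit 1 ⊞ L ⊞ (|q| ⊞ |s|))
    o : OccursAt u q i
    o = proj₁ (occ-++⁻ q s (trans (cong (λ k → u [ i , k ]) (trans (length-++ q) (sym len≡))) e′))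

  newPalAt⁻ : ∀ {i L} → NewPalAt i L → ∃ (NewPalPrefix (u i) (u [ suc i , L ]))
  newPalAt⁻ {i} {L} (l , a , p , h) with m≤n⇒∃[o]m+o≡n a
  ... | r , eq =
      u [ i , l ] , (u [ i + l , r ] , trans (sym (win-∷ i L)) (trans (cong (λ k → u [ i , k ]) (sym eq)) (win-++ i l r)))
    , palSegment⁻ i l p , λ inf → let (j , b , c , o) = infix-win⁻ inf in
      h j b (lin (c ⊕ ≡⇒≥ (length-win i l))
          (≤-solve (j ∷ l ∷ i ∷ L ∷ length (u [ i , l ]) ∷ [])
          λ j l i L |uil| → j ⊞ l ⊞ (lit 1 ⊞ i ⊞ L ⊞ |uil|) ≼ i ⊞ (lit 1 ⊞ L) ⊞ (j ⊞ |uil| ⊞ l))) o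

-- Bounded search, and richness from palindromic mirror returns.

module _ {P : ℕ → Set} (P? : Decidable P) where

  first-from : ∀ i d → P (i + d) → ∃ λ k → i ≤ k × k ≤ i + d × P k × (∀ l → i ≤ l → l < k → ¬ P l)
  first-from i zero p = i , ≤-refl , m≤m+n i 0 , subst P (+-identityʳ i) p , λ l a b _ → lin⊥ (a ⊕ b)
      (≤-solve (l ∷ i ∷ []) λ l i → lit 1 ⊞ (l ⊞ i) ≼ i ⊞ (lit 1 ⊞ l))
  first-from i (suc d) p with P? i
  ... | yes q = i , ≤-refl , m≤m+n i _ , q , λ l a b _ → lin⊥ (a ⊕ b)
      (≤-solve (l ∷ i ∷ []) λ l i → lit 1 ⊞ (l ⊞ i) ≼ i ⊞ (lit 1 ⊞ l))
  ... | no ¬q with first-from (suc i) d (subst P (+-suc i d) p)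
  ... | k , a , b , pk , h = k , <⇒≤ a , ≤-trans b (≤-reflexive (sym (+-suc i d))) , pk , h′
    where
    h′ : ∀ l → i ≤ l → l < k → ¬ P l
    h′ l c e pl with m≤n⇒m<n∨m≡n c
    ... | inj₁ c′ = h l c′ e pl
    ... | inj₂ refl = ¬q pl

  last-upto : ∀ i d → P i → ∃ λ k → i ≤ k × k ≤ i + d × P k × (∀ l → k < l → l ≤ i + d → ¬ P l)
  last-upto i zero p = i , ≤-refl , m≤m+n i 0 , p , λ l a b _ → lin⊥ (a ⊕ b)
      (≤-solve (l ∷ i ∷ []) λ l i → lit 1 ⊞ (l ⊞ (i ⊞ lit 0)) ≼ lit 1 ⊞ i ⊞ l)
  last-upto i (suc d) p with P? (i + suc d)
  ... | yes q = i + suc d , m≤m+n i _ , ≤-refl , q , λ l a b _ → lin⊥ (a ⊕ b)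
      (≤-solve (l ∷ i ∷ d ∷ []) λ l i d → lit 1 ⊞ (l ⊞ (i ⊞ (lit 1 ⊞ d))) ≼ lit 1 ⊞ (i ⊞ (lit 1 ⊞ d)) ⊞ l)
  ... | no ¬q with last-upto i d p
  ... | k , a , b , pk , h = k , a , lin b
      (≤-solve (k ∷ i ∷ d ∷ []) λ k i d → k ⊞ (i ⊞ d) ≼ i ⊞ (lit 1 ⊞ d) ⊞ k) , pk , h′
    where
    h′ : ∀ l → k < l → l ≤ i + suc d → ¬ P l
    h′ l c e pl with m≤n⇒m<n∨m≡n e
    ... | inj₁ e′ = h l c (lin e′
        (≤-solve (l ∷ i ∷ d ∷ []) λ l i d → l ⊞ (i ⊞ (lit 1 ⊞ d)) ≼ i ⊞ d ⊞ (lit 1 ⊞ l))) pl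
    ... | inj₂ refl = ¬q pl

  last-before : ∀ i j → i < j → P i → ∃ λ k → i ≤ k × k < j × P k × (∀ l → k < l → l < j → ¬ P l)
  last-before i j a p with m≤n⇒∃[o]m+o≡n a
  ... | d , refl with last-upto i d p
  ... | k , b , c , pk , h = k , b , s≤s c , pk , λ l e f → h l e (s≤s⁻¹ f)

  first-between : ∀ i j → i ≤ j → P j → ∃ λ k → i ≤ k × k ≤ j × P k × (∀ l → i ≤ l → l < k → ¬ P l)
  first-between i j a p with m≤n⇒∃[o]m+o≡n a
  ... | d , refl = first-from i d p

module Rich {n : ℕ} (u : InfWord n) (good : ∀ x → x ≢ [] → Windows.PalReturns u x) where
  open Windows u
  open NewPalindromes u

  -- The longest palindromic prefix of the window cannot recur in it: together with its next
  -- occurrence it would span a palindromic return, which is a longer palindromic prefix.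
  newPal : ∀ i L → NewPalAt i L
  newPal i L with last-upto (λ l → palSegment? i l) 1 L (palSegment-letter i)
  ... | l , a , b , p , h = l , b , p , repeat
    where
    repeat : ∀ j → i < j → j + l ≤ i + suc L → ¬ OccursAt u (u [ i , l ]) j
    repeat j c e o = extend (u [ i , l ]) (length-win i l) (occ-win i l) (palSegment⁻ i l p) o
      where
      extend : ∀ q → length q ≡ l → OccursAt u q i → Palindrome q → OccursAt u q j → ⊥
      extend q refl oi pal o with first-between (λ k → (u [ k , length q ]) ≟ʷ q) (suc i) j c o
      ... | k , f , g , ok , hk with m≤n⇒∃[o]m+o≡n f
      ... | d , refl = h (suc d + length q)
          (≤-solve (length q ∷ d ∷ []) λ |q| d → lit 1 ⊞ |q| ≼ lit 1 ⊞ d ⊞ |q|) (lin (g ⊕ e)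
          (≤-solve (d ∷ length q ∷ j ∷ i ∷ L ∷ []) λ d |q| j i L → lit 1 ⊞ d ⊞ |q| ⊞ (j ⊞ (i ⊞ (lit 1 ⊞ L))) ≼
          lit 1 ⊞ L ⊞ (lit 1 ⊞ (i ⊞ d) ⊞ (j ⊞ |q|))))
          (subst (PalSegment i)
              (≡-solve (i ∷ d ∷ length q ∷ []) λ i d |q| → lit 1 ⊞ (i ⊞ d) ⊞ |q| ≼
              i ⊞ (lit 1 ⊞ d ⊞ |q|)) (good q nonempty i k (mirrorReturn f (inj₁ oi) (inj₁ ok) inner)))
        where
        nonempty : q ≢ []
        nonempty e = lin⊥ (a ⊕ ≡⇒≤ (cong length e))
            (≤-solve (length q ∷ []) λ |q| → lit 1 ⊞ (|q| ⊞ lit 0) ≼ lit 1 ⊞ |q|)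
        inner : ∀ m → i < m → m < k → ¬ MirrorOcc q m
        inner m x y (inj₁ z) = hk m x y z
        inner m x y (inj₂ z) = hk m x y (subst (λ w → OccursAt u w m) (sym pal) z)

  palCount-win : ∀ L i → suc L ≤ palCount (u [ i , L ])
  palCount-win zero i = ≡⇒≥ palCount-[]
  palCount-win (suc L) i = let (q , new) = newPalAt⁻ (newPal i L) in
    ≤-trans (s≤s (palCount-win L (suc i)))
      (≤-trans (palCount-new new) (≤-reflexive (cong palCount (sym (win-∷ i L)))))

  factor-rich : ∀ w → IsFactor u w → suc (length w) ≤ palCount w
  factor-rich w (i , o) = ≤-trans (palCount-win (length w) i) (≤-reflexive (cong palCount o))

-- Consequences of finite defect for uniformly recurrent words.

UniformlyRecurrent : ∀ {n} → InfWord n → Set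
UniformlyRecurrent u =
    ∀ w → IsFactor u w → ∃ λ G → ∀ p → ∃ λ q → p ≤ q × q + length w ≤ p + G × OccursAt u w q

module _ {n : ℕ} (u : InfWord n) where
  open Windows u
  open NewPalindromes u

  record MaxDefect : Set where
    field
      word    : Word n
      factor  : IsFactor u word
      value   : ℕ
      attains : palCount word + value ≤ suc (length word)
      bound   : ∀ w → IsFactor u w → suc (length w) ≤ palCount w + value

  -- A bound that no factor attains can be lowered by one, and the empty word stops this descent at
  -- 0. Whether a bound is attained is not decided, hence the double negation.
  maxDefect : ∀ s → (∀ w → IsFactor u w → suc (length w) ≤ palCount w + s) → ¬ ¬ MaxDefect
  maxDefect s b k =
      descend s b (λ w f → ≰⇒> (λ a → k (record { word =
      w ; factor = f ; value = s ; attains = a ; bound = b })))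
    where
    descend : ∀ s → (∀ w → IsFactor u w → suc (length w) ≤ palCount w + s) →
              (∀ w → IsFactor u w → suc (length w) < palCount w + s) → ⊥
    descend zero b st with st [] (0 , refl)
    ... | a = lin⊥ (a ⊕ ≡⇒≤ (palCount-[] {n}))
        (≤-solve (palCount {n} [] ∷ []) λ #n → lit 1 ⊞ (#n ⊞ lit 0 ⊞ lit 1) ≼ lit 2 ⊞ #n)
    descend (suc s) b st = maxDefect s
      (λ w f → shift (st w f)) k
      where
      shift : ∀ {a b} → suc a ≤ b + suc s → a ≤ b + s
      shift {a} {b} h = lin h (≤-solve (a ∷ b ∷ s ∷ []) λ a b s → a ⊞ (b ⊞ (lit 1 ⊞ s)) ≼ b ⊞ s ⊞ (lit 1 ⊞ a))

  EventuallyNew : ℕ → Set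
  EventuallyNew N = ∀ i L → N ≤ L → NewPalAt i L

  -- Every window of length at least `G` contains `w₀`, so its defect is already maximal; a letter
  -- prepended without a new palindrome would raise it further.
  eventuallyNew : UniformlyRecurrent u → MaxDefect → ∃ EventuallyNew
  eventuallyNew ur record { word = w₀ ; factor = f ; value = s ; attains = at ; bound = bd } with ur w₀ f
  ... | G , rec = G , new
    where
    new : EventuallyNew G
    new i L G≤L with new-or-old (u i) (u [ suc i , L ])
    ... | inj₁ (q , nq) = newPalAt⁺ nq
    ... | inj₂ c with rec (suc i)
    ... | j , a , b , o = ⊥-elim (contra c
        (palCount-infix (infix-win⁺ {w₀} {suc i} {L} a (lin (b ⊕ G≤L)
            (≤-solve (j ∷ length w₀ ∷ i ∷ G ∷ L ∷ []) λ j |w₀| i G L → j ⊞ |w₀| ⊞ (lit 1 ⊞ (i ⊞ G) ⊞ L) ≼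
            lit 1 ⊞ i ⊞ L ⊞ (j ⊞ |w₀| ⊞ G))) o)) at
        (bd (u i ∷ u [ suc i , L ]) (i , trans (cong (λ k → u [ i , suc k ]) (length-win (suc i) L)) (win-∷ i L))))
      where
      contra : ∀ {p p′ p₀ l l₀} → p′ ≤ p → p + l₀ ≤ p₀ + l → p₀ + s ≤ suc l₀ → suc (suc l) ≤ p′ + s → ⊥
      contra {p} {p′} {p₀} {l} {l₀} e₁ e₂ e₃ e₄ = lin⊥ (e₁ ⊕ e₂ ⊕ e₃ ⊕ e₄)
          (≤-solve (p ∷ p₀ ∷ l ∷ l₀ ∷ p′ ∷ s ∷ [])
          λ p p₀ l l₀ p′ s → lit 1 ⊞ (p ⊞ (p₀ ⊞ l ⊞ (lit 1 ⊞ l₀ ⊞ (p′ ⊞ s)))) ≼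
          p′ ⊞ (p ⊞ l₀ ⊞ (p₀ ⊞ s ⊞ (lit 1 ⊞ (lit 1 ⊞ l)))))

  mirrorOcc-compare : ∀ x {i j} → MirrorOcc x i → MirrorOcc x j →
    u [ i , length x ] ≡ u [ j , length x ] ⊎ reverse (u [ i , length x ]) ≡ u [ j , length x ]
  mirrorOcc-compare x {i} {j} p q = go p q
    where
    rev : ∀ {k} → OccursAt u (reverse x) k → u [ k , length x ] ≡ reverse x
    rev {k} o = trans (cong (λ m → u [ k , m ]) (sym (length-reverse x))) o
    go : MirrorOcc x i → MirrorOcc x j → _
    go (inj₁ o) (inj₁ o′) = inj₁ (trans o (sym o′))
    go (inj₁ o) (inj₂ o′) = inj₂ (trans (cong reverse o) (sym (rev o′)))
    go (inj₂ o) (inj₁ o′) = inj₂ (trans (cong reverse (rev o)) (trans (reverse-involutive x) (sym o′)))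
    go (inj₂ o) (inj₂ o′) = inj₁ (trans (rev o) (sym (rev o′)))

  win-prefix : ∀ {i j l m} → l ≤ m → u [ i , m ] ≡ u [ j , m ] → u [ i , l ] ≡ u [ j , l ]
  win-prefix {i} {j} {l} a e with m≤n⇒∃[o]m+o≡n a
  ... | r , refl =
      proj₁ (++-injective (u [ i , l ]) (u [ j , l ]) (trans (length-win i l) (sym (length-win j l)))
    (trans (sym (win-++ i l r)) (trans e (win-++ j l r))))

  -- The new palindromic prefix of the return is all of it. If it is no longer than `x`, the
  -- occurrence at `j` repeats it, at its beginning or, when mirrored, at its end. If it is longer
  -- but not the whole return, it reflects the occurrence at `i` to a forbidden inner one.
  long-palReturns : ∀ {N} → EventuallyNew N → ∀ x → N ≤ length x → PalReturns x
  long-palReturns {N} new x N≤ i j (mirrorReturn i<j st en inn) with m≤n⇒∃[o]m+o≡n i<j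
  ... | d , refl with new i (d + length x) (lin N≤
      (≤-solve (N ∷ length x ∷ d ∷ []) λ N |x| d → N ⊞ |x| ≼ d ⊞ |x| ⊞ N))
  ... | l , a , p , unrep with <-≤-connex (length x) l
  ... | inj₂ l≤m = ⊥-elim (repeated (mirrorOcc-compare x st en))
    where
    at : ∀ {k} → u [ i , l ] ≡ u [ k , l ] → OccursAt u (u [ i , l ]) k
    at {k} e = trans (cong (λ m → u [ k , m ]) (length-win i l)) (sym e)
    repeated : u [ i , length x ] ≡ u [ j , length x ] ⊎ reverse (u [ i , length x ]) ≡ u [ j , length x ] → ⊥
    repeated (inj₁ e) = unrep j i<j (lin l≤m
        (≤-solve (i ∷ d ∷ l ∷ length x ∷ []) λ i d l |x| → lit 1 ⊞ (i ⊞ d) ⊞ l ⊞ |x| ≼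
        i ⊞ (lit 1 ⊞ (d ⊞ |x|)) ⊞ l)) (at (win-prefix l≤m e))
    repeated (inj₂ e) with m≤n⇒∃[o]m+o≡n l≤m
    ... | r , eq = unrep (j + r)
        (≤-solve (i ∷ d ∷ r ∷ []) λ i d r → lit 1 ⊞ i ≼ lit 1 ⊞ (i ⊞ d) ⊞ r) (lin (≡⇒≤ eq)
        (≤-solve (i ∷ d ∷ r ∷ l ∷ length x ∷ []) λ i d r l |x| → lit 1 ⊞ (i ⊞ d) ⊞ r ⊞ l ⊞ |x| ≼
        i ⊞ (lit 1 ⊞ (d ⊞ |x|)) ⊞ (l ⊞ r))) (at (trans (palSegment⁻ i l p)
      (reverse-win⁺ l i (j + r) (λ s t b c f → reverse-win⁻ (length x) i j e s t b (lin c
          (≤-solve (i ∷ d ∷ t ∷ r ∷ []) λ i d t r → lit 1 ⊞ (i ⊞ d) ⊞ t ≼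
          t ⊞ (lit 1 ⊞ (i ⊞ d) ⊞ r))) (lin≡ (f ⊕≡ eq)
          (≡-solve (s ∷ t ∷ i ∷ d ∷ r ∷ l ∷ length x ∷ [])
          λ s t i d r l |x| → lit 1 ⊞ (s ⊞ t) ⊞ (i ⊞ (lit 1 ⊞ (i ⊞ d) ⊞ r) ⊞ l ⊞ |x|) ≼
          i ⊞ (lit 1 ⊞ (i ⊞ d)) ⊞ |x| ⊞ (lit 1 ⊞ (s ⊞ t) ⊞ (l ⊞ r))))))))
  ... | inj₁ m<l with m≤n⇒∃[o]m+o≡n m<l
  ... | r , refl with mirrorOcc-reflect x {p′ = i + suc r} p
      (≡-solve (i ∷ r ∷ length x ∷ []) λ i r |x| → i ⊞ (i ⊞ (lit 1 ⊞ r)) ⊞ |x| ≼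
      i ⊞ (i ⊞ (lit 1 ⊞ (|x| ⊞ r)))) ≤-refl (≤-solve (i ∷ r ∷ []) λ i r → i ≼ i ⊞ (lit 1 ⊞ r)) st
  ... | o with m≤n⇒m<n∨m≡n (lin {x = i + suc r} {suc (i + d)} a
      (≤-solve (i ∷ r ∷ d ∷ length x ∷ []) λ i r d |x| → i ⊞ (lit 1 ⊞ r) ⊞ (lit 1 ⊞ (d ⊞ |x|)) ≼
      lit 1 ⊞ (i ⊞ d) ⊞ (lit 1 ⊞ (|x| ⊞ r))))
  ... | inj₁ lt = ⊥-elim (inn (i + suc r) (≤-solve (i ∷ r ∷ []) λ i r → lit 1 ⊞ i ≼ i ⊞ (lit 1 ⊞ r)) (lin lt
      (≤-solve (i ∷ r ∷ d ∷ []) λ i r d → lit 1 ⊞ (i ⊞ (lit 1 ⊞ r)) ⊞ (lit 1 ⊞ (i ⊞ d)) ≼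
      lit 1 ⊞ (i ⊞ d) ⊞ (lit 1 ⊞ (i ⊞ (lit 1 ⊞ r))))) o)
  ... | inj₂ eq = subst (PalSegment i) (lin≡ eq
      (≡-solve (i ∷ length x ∷ r ∷ d ∷ []) λ i |x| r d → i ⊞ (lit 1 ⊞ (|x| ⊞ r)) ⊞ (lit 1 ⊞ (i ⊞ d)) ≼
      lit 1 ⊞ (i ⊞ d ⊞ |x|) ⊞ (i ⊞ (lit 1 ⊞ r)))) p

  -- The prefix of length `G` contains `w` and recurs at some `q` ≥ 1. A palindromic prefix that is
  -- not repeated in a window reaching past this recurrence is longer than `G`; so it contains `w`,
  -- and with it the mirror image of `w`.
  reversal-closed : UniformlyRecurrent u → ∀ {N} → EventuallyNew N → ∀ w → IsFactor u w →
      IsFactor u (reverse w)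
  reversal-closed ur {N} new w f with ur w f
  ... | G , rec with ur (u [ 0 , G ]) (0 , occ-win 0 G)
  ... | G′ , rec′ with rec′ 1
  ... | q , a , b , o with new 0 (N + (q + G)) (≤-solve (N ∷ q ∷ G ∷ []) λ N q G → N ≼ N ⊞ (q ⊞ G))
  ... | l , c , p , unrep with ≤-<-connex l G
  ... | inj₁ l≤G = ⊥-elim (unrep q a (lin l≤G
      (≤-solve (q ∷ l ∷ G ∷ N ∷ []) λ q l G N → q ⊞ l ⊞ G ≼ lit 1 ⊞ (N ⊞ (q ⊞ G)) ⊞ l))
      (trans (cong (λ m → u [ q , m ]) (length-win 0 l)) (win-prefix l≤G (trans (cong (λ m → u [ q , m ]) (sym (length-win 0 G))) o))))
  ... | inj₂ G<l with rec 0
  ... | k , _ , e , ok with m≤n⇒∃[o]m+o≡n (≤-trans e (<⇒≤ G<l))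
  ... | r , eq = r , occ-reflect w p (lin≡ eq
      (≡-solve (k ∷ r ∷ length w ∷ l ∷ []) λ k r |w| l → k ⊞ r ⊞ |w| ⊞ l ≼
      lit 0 ⊞ l ⊞ (k ⊞ |w| ⊞ r))) z≤n z≤n ok

-- Extension graphs and their acyclicity for palindromic returns.

ReversalClosed : ∀ {n} → InfWord n → Set
ReversalClosed u = ∀ w → IsFactor u w → IsFactor u (reverse w)

data Vertex (n : ℕ) : Set where
  left right : Fin n → Vertex n

-- The extension graph of a factor z: left y stands for the word yz, right y for zy, and every
-- factor y z y′ is an edge. If z is a palindrome then yz and zy are mirror images of each other.
module ExtensionGraph {n : ℕ} (u : InfWord n) where

  ext : Word n → Vertex n → Word n
  ext z (left y)  = y ∷ z
  ext z (right y) = z ∷ʳ y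

  data Adjacent (z : Word n) : Vertex n → Vertex n → Set where
    edge  : ∀ {y y′} → IsFactor u (y ∷ z ∷ʳ y′) → Adjacent z (left y) (right y′)
    edgeᵒ : ∀ {y y′} → IsFactor u (y ∷ z ∷ʳ y′) → Adjacent z (right y′) (left y)
    flip  : ∀ {y} → Palindrome z → Adjacent z (left y) (right y)
    flipᵒ : ∀ {y} → Palindrome z → Adjacent z (right y) (left y)

  Avoids : Word n → Word n → Set
  Avoids C V = V ≢ C × V ≢ reverse C

  Step : Word n → Word n → Vertex n → Vertex n → Set
  Step z C v v′ = Avoids C (ext z v) × Avoids C (ext z v′) × Adjacent z v v′

  Path : Word n → Word n → Vertex n → Vertex n → Set
  Path z C = Star (Step z C)

module Acyclic {n : ℕ} (u : InfWord n) (ur : UniformlyRecurrent u) (rc : ReversalClosed u)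
  (z : Word n) (good : ∀ V → length V ≡ suc (length z) → Windows.PalReturns u V) (c : Fin n) where
  open Windows u
  open ExtensionGraph u

  C : Word n
  C = c ∷ z

  -- Some occurrence of V or its mirror image at i is followed, with s = u k just before it, by the
  -- next occurrence of C or its mirror image at suc k: s is the direction of C as seen from V.
  Towards : Word n → ℕ → Fin n → Set
  Towards V i s = MirrorOcc V i × (∃ λ k → i ≤ k × u k ≡ s × MirrorOcc C (suc k) ×
                  (∀ l → i ≤ l → l ≤ k → ¬ MirrorOcc C l))

  Direction : Word n → Fin n → Set
  Direction V s = ∃ λ i → Towards V i s

  occ-same : ∀ {V W : Word n} {k} → length V ≡ length W → OccursAt u V k → OccursAt u W k → V ≡ W
  occ-same {k = k} e o o′ = trans (sym o) (trans (cong (λ m → u [ k , m ]) e) o′)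

  mirrorOcc-avoids : ∀ {V : Word n} {k} → length V ≡ suc (length z) → Avoids C V → MirrorOcc V k →
      ¬ MirrorOcc C k
  mirrorOcc-avoids e (a , b) (inj₁ o) (inj₁ o′) = a (occ-same e o o′)
  mirrorOcc-avoids e (a , b) (inj₁ o) (inj₂ o′) = b (occ-same (trans e (sym (length-reverse C))) o o′)
  mirrorOcc-avoids {V} e (a , b) (inj₂ o) (inj₁ o′) =
    b (trans (sym (reverse-involutive V)) (cong reverse (occ-same (trans (length-reverse V) e) o o′)))
  mirrorOcc-avoids {V} e (a , b) (inj₂ o) (inj₂ o′) =
    a (reverse-injective (occ-same (trans (length-reverse V) (trans e (sym (length-reverse C)))) o o′))

  module _ (Cf : IsFactor u C) where

    towards : ∀ {V : Word n} {i} → MirrorOcc V i → ¬ MirrorOcc C i → ∃ λ s → Towards V i s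
    towards {V} {i} o ¬c with ur C Cf
    ... | G , rec with rec i
    ... | q , a , _ , oq with first-between (mirrorOcc? C) i q a (inj₁ oq)
    ... | k , b , _ , ok , h with m≤n⇒m<n∨m≡n {i} {k} b
    ... | inj₂ refl = ⊥-elim (¬c ok)
    ... | inj₁ (s≤s {n = k′} i≤k′) = u k′ , o , k′ , i≤k′ , refl , ok , λ l x y → h l x (s≤s y)

    module _ {V : Word n} (len : length V ≡ suc (length z)) where

      -- The palindromic return to V starting at i reflects the way to C at suc k into the way
      -- leaving the last C before the next V, and the palindromic return to that C reflects it back.
      towards-next : ∀ {i k e} → MirrorReturn V i (suc k + e) → i ≤ k → MirrorOcc C (suc k) →
                     (∀ l → i ≤ l → l ≤ k → ¬ MirrorOcc C l) → Towards V (suc k + e) (u k)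
      towards-next {i} {k} {e} ret i≤k ok free = step (ur C Cf)
        where
        seg : PalSegment i (suc k + e + length V)
        seg = good V len i (suc k + e) ret
        ok* : MirrorOcc C (i + e)
        ok* = mirrorOcc-reflect C seg (lin≡ (sym len)
            (≡-solve (k ∷ i ∷ e ∷ length z ∷ length V ∷ [])
            λ k i e |z| |V| → lit 1 ⊞ (k ⊞ (i ⊞ e) ⊞ (lit 1 ⊞ |z|) ⊞ |V|) ≼
            i ⊞ (lit 1 ⊞ (k ⊞ e ⊞ |V|)) ⊞ (lit 1 ⊞ |z|))) (m≤n⇒m≤1+n i≤k) (m≤m+n i e) ok
        step : (∃ λ G → ∀ p → ∃ λ q → p ≤ q × q + length C ≤ p + G × OccursAt u C q) →
            Towards V (suc k + e) (u k)
        step (G , rec) with rec (suc k + e)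
        ... | q , a , _ , oq with first-between (mirrorOcc? C) (suc (i + e)) q (lin (a ⊕ i≤k)
            (≤-solve (i ∷ e ∷ q ∷ k ∷ []) λ i e q k → lit 1 ⊞ (i ⊞ e) ⊞ (q ⊞ k) ≼
            q ⊞ (lit 1 ⊞ (k ⊞ e) ⊞ i))) (inj₁ oq)
        ... | suc k₂ , s≤s b , _ , ok₂ , h with ≤-<-connex (suc k₂) (suc k + e)
        -- A `C` found after `i + e` but not beyond the next `V` would be reflected to one between
        -- `i` and `k`.
        ... | inj₁ le with m≤n⇒∃[o]m+o≡n le
        ... | t , eq = ⊥-elim (free (i + t) (m≤m+n i t) (lin (b ⊕ ≡⇒≤ eq)
            (≤-solve (i ∷ t ∷ k₂ ∷ k ∷ e ∷ []) λ i t k₂ k e → i ⊞ t ⊞ (k₂ ⊞ (lit 1 ⊞ (k ⊞ e))) ≼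
            k ⊞ (i ⊞ e ⊞ (lit 1 ⊞ (k₂ ⊞ t)))))
              (mirrorOcc-reflect C seg (lin≡ (sym len ⊕≡ eq)
                  (≡-solve (k₂ ∷ i ∷ t ∷ length z ∷ length V ∷ k ∷ e ∷ [])
                  λ k₂ i t |z| |V| k e → lit 1 ⊞ (k₂ ⊞ (i ⊞ t) ⊞ (lit 1 ⊞ |z|) ⊞ (|V| ⊞ (lit 1 ⊞ (k ⊞ e)))) ≼
                  i ⊞ (lit 1 ⊞ (k ⊞ e ⊞ |V|)) ⊞ (lit 1 ⊞ (|z| ⊞ (lit 1 ⊞ (k₂ ⊞ t)))))) (lin b
                  (≤-solve (i ∷ k₂ ∷ e ∷ []) λ i k₂ e → i ⊞ k₂ ≼ lit 1 ⊞ k₂ ⊞ (i ⊞ e))) (m≤m+n i t) ok₂))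
        step (G , rec) | q , a , _ , oq | suc k₂ , s≤s b , _ , ok₂ , h | inj₂ (s≤s gt) =
          MirrorReturn.end ret , k₂ , gt , sym (trans u₁ u₂) , ok₂ ,
          λ l x y → h l (lin (x ⊕ i≤k)
              (≤-solve (i ∷ e ∷ l ∷ k ∷ []) λ i e l k → lit 1 ⊞ (i ⊞ e) ⊞ (l ⊞ k) ≼
              l ⊞ (lit 1 ⊞ (k ⊞ e) ⊞ i))) (s≤s y)
          where
          seg₂ : PalSegment (i + e) (suc k₂ + length C)
          seg₂ = good C refl (i + e) (suc k₂) (mirrorReturn (s≤s b) ok* ok₂ h)
          u₁ : u k ≡ u (i + e + length C)
          u₁ = seg k (i + e + length C) i≤k
              (≤-solve (i ∷ e ∷ length C ∷ []) λ i e |C| → i ≼ i ⊞ e ⊞ |C|) (lin≡ (sym len)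
              (≡-solve (k ∷ i ∷ e ∷ length z ∷ length V ∷ [])
              λ k i e |z| |V| → lit 1 ⊞ (k ⊞ (i ⊞ e ⊞ (lit 1 ⊞ |z|)) ⊞ |V|) ≼
              i ⊞ (lit 1 ⊞ (k ⊞ e ⊞ |V|)) ⊞ (lit 1 ⊞ |z|)))
          u₂ : u (i + e + length C) ≡ u k₂
          u₂ = seg₂ (i + e + length C) k₂
              (≤-solve (i ∷ e ∷ length C ∷ []) λ i e |C| → i ⊞ e ≼ i ⊞ e ⊞ |C|) b
              (≡-solve (i ∷ e ∷ length C ∷ k₂ ∷ []) λ i e |C| k₂ → lit 1 ⊞ (i ⊞ e ⊞ |C| ⊞ k₂) ≼
              i ⊞ e ⊞ (lit 1 ⊞ k₂ ⊞ |C|))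

      -- Induction over the successive occurrences of `V` from `i` to `i + d`. If the next `V` comes
      -- before the next `C`, both see the same `C`; otherwise `towards-next` hands the letter on.
      -- At distance 0 both data describe the first `C` from one position.
      towards-unique : ∀ fuel d {i s s′} → d ≤ fuel → Towards V i s → Towards V (i + d) s′ → s ≡ s′
      towards-unique fuel zero {i} le (o , k , a , refl , ok , free) (o′ , k′ , a′ , refl , ok′ , free′)
        with <-cmp k k′
      ... | tri≈ _ refl _ = refl
      ... | tri< lt _ _ = ⊥-elim (free′ (suc k) (lin a
          (≤-solve (i ∷ k ∷ []) λ i k → i ⊞ lit 0 ⊞ k ≼ lit 1 ⊞ k ⊞ i)) lt ok)
      ... | tri> _ _ gt = ⊥-elim (free (suc k′) (lin a′
          (≤-solve (i ∷ k′ ∷ []) λ i k′ → i ⊞ k′ ≼ lit 1 ⊞ k′ ⊞ (i ⊞ lit 0))) gt ok′)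
      towards-unique (suc fuel) (suc d) {i} {s} {s′} (s≤s le) (o , k , a , eqs , ok , free) t′@(o′ , _)
        with first-between (mirrorOcc? V) (suc i) (i + suc d)
            (≤-solve (i ∷ d ∷ []) λ i d → lit 1 ⊞ i ≼ i ⊞ (lit 1 ⊞ d)) o′
      ... | j , i<j , j≤ , oj , h = next (m≤n⇒∃[o]m+o≡n j≤)
        where
        ret : MirrorReturn V i j
        ret = mirrorReturn i<j o oj h
        at-j : Dec (j ≤ k) → Towards V j s
        at-j (yes j≤k) = oj , k , j≤k , eqs , ok , λ l x → free l (≤-trans (<⇒≤ i<j) x)
        at-j (no j≰k) with m≤n⇒∃[o]m+o≡n (≰⇒> j≰k)
        ... | e , refl = subst (Towards V _) eqs (towards-next ret a ok free)
        next : (∃ λ r → j + r ≡ i + suc d) → s ≡ s′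
        next (r , eq) = towards-unique fuel r (lin (≡⇒≤ eq ⊕ i<j ⊕ le)
            (≤-solve (r ∷ i ∷ d ∷ j ∷ fuel ∷ []) λ r i d j fuel → r ⊞ (i ⊞ (lit 1 ⊞ d) ⊞ (j ⊞ fuel)) ≼
            fuel ⊞ (j ⊞ r ⊞ (lit 1 ⊞ i ⊞ d)))) (at-j (j ≤? k))
          (subst (λ m → Towards V m s′) (sym eq) t′)

      direction-unique : ∀ {s s′} → Direction V s → Direction V s′ → s ≡ s′
      direction-unique (i , t) (i′ , t′) with ≤-total i i′
      ... | inj₁ le with m≤n⇒∃[o]m+o≡n le
      ... | d , refl = towards-unique d d ≤-refl t t′
      direction-unique (i , t) (i′ , t′) | inj₂ le with m≤n⇒∃[o]m+o≡n le
      ... | d , refl = sym (towards-unique d d ≤-refl t′ t)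

    module _ {V V′ : Word n} (len : length V ≡ suc (length z)) (len′ : length V′ ≡ suc (length z))
             (av : Avoids C V) (av′ : Avoids C V′) {i : ℕ} (o : MirrorOcc V i) (o′ : MirrorOcc V′ (suc i)) where

      private
        -- The first `C` after `i` does not start at `suc i`, since `V′` occurs there and differs
        -- from `C` and its mirror image. So `V` and `V′` see the same one.
        common : ∃ λ s → Direction V s × Direction V′ s
        common with towards o (mirrorOcc-avoids len av o)
        ... | s , t@(_ , k , a , e , ok , free) with m≤n⇒m<n∨m≡n a
        ... | inj₁ a′ = s , (i , t) , (suc i , o′ , k , a′ , e , ok , λ l x → free l (<⇒≤ x))
        ... | inj₂ refl = ⊥-elim (mirrorOcc-avoids len′ av′ o′ ok)

      direction-edge : ∀ {s} → Direction V s → Direction V′ s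
      direction-edge d = let (s , d₁ , d₂) = common in subst (Direction V′) (direction-unique len d₁ d) d₂

      direction-edgeᵒ : ∀ {s} → Direction V′ s → Direction V s
      direction-edgeᵒ d = let (s , d₁ , d₂) = common in subst (Direction V) (direction-unique len′ d₂ d) d₁

    direction-reverse : ∀ {V V′ s} → V′ ≡ reverse V → Direction V s → Direction V′ s
    direction-reverse {V} refl (i , inj₁ o , t) =
        i , inj₂ (subst (λ w → OccursAt u w i) (sym (reverse-involutive V)) o) , t
    direction-reverse refl (i , inj₂ o , t) = i , inj₁ o , t

    length-ext : ∀ v → length (ext z v) ≡ suc (length z)
    length-ext (left y) = refl
    length-ext (right y) = trans (length-++ z) (+-comm (length z) 1)

    reverse-∷-pal : ∀ y → Palindrome z → z ∷ʳ y ≡ reverse (y ∷ z)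
    reverse-∷-pal y p = trans (cong (_∷ʳ y) p) (sym (unfold-reverse y z))

    direction-step : ∀ {v v′ s} → Step z C v v′ → Direction (ext z v) s → Direction (ext z v′) s
    direction-step {left y} {right y′} (av , av′ , edge (i , o)) =
      direction-edge (length-ext (left y)) (length-ext (right y′)) av av′
        (inj₁ (proj₁ (occ-∷ʳ⁻ y′ (y ∷ z) o))) (inj₁ (proj₂ (occ-∷⁻ y (z ∷ʳ y′) o)))
    direction-step {right y′} {left y} (av′ , av , edgeᵒ (i , o)) =
      direction-edgeᵒ (length-ext (left y)) (length-ext (right y′)) av av′
        (inj₁ (proj₁ (occ-∷ʳ⁻ y′ (y ∷ z) o))) (inj₁ (proj₂ (occ-∷⁻ y (z ∷ʳ y′) o)))
    direction-step {left y} (_ , _ , flip p) = direction-reverse (reverse-∷-pal y p)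
    direction-step {right y} (_ , _ , flipᵒ p) = direction-reverse
      (trans (sym (reverse-involutive (y ∷ z))) (cong reverse (sym (reverse-∷-pal y p))))

    -- In the mirror image a z̃ c of the factor c z a, the mirror image of `C` starts right after
    -- the first letter of a z̃, and this letter is a.
    direction-neighbour : ∀ {a} → Avoids C (z ∷ʳ a) → IsFactor u (c ∷ z ∷ʳ a) → Direction (z ∷ʳ a) a
    direction-neighbour {a} av f with rc _ f
    ... | i , o = i , oV , i , ≤-refl , proj₁ oC , inj₂ (proj₂ oC) , λ l x y oC′ →
        mirrorOcc-avoids (length-ext (right a)) av oV (subst (MirrorOcc C) (≤-antisym y x) oC′)
      where
      oV : MirrorOcc (z ∷ʳ a) i
      oV = inj₂ (proj₁ (occ-∷ʳ⁻ c (reverse (z ∷ʳ a)) (subst (λ w → OccursAt u w i) (unfold-reverse c (z ∷ʳ a)) o)))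
      oC : u i ≡ a × OccursAt u (reverse C) (suc i)
      oC = occ-∷⁻ a (reverse C) (subst (λ w → OccursAt u w i) (reverse-++ C (a ∷ [])) o)

    path-closed : ∀ {v v′ s} → Path z C v v′ → Direction (ext z v) s → Direction (ext z v′) s
    path-closed ε d = d
    path-closed (st ◅ p) d = path-closed p (direction-step st d)

  -- The direction is constant along a path avoiding `C`, and at its two ends it equals `a` and `b`.
  acyclic : ∀ {a b} → Avoids C (z ∷ʳ a) → Avoids C (z ∷ʳ b) → IsFactor u (c ∷ z ∷ʳ a) →
      IsFactor u (c ∷ z ∷ʳ b) →
            Path z C (right a) (right b) → a ≡ b
  acyclic {a} {b} av av′ fa@(i , o) fb p =
    direction-unique Cf (length-ext Cf (right b)) (path-closed Cf p (direction-neighbour Cf av fa)) (direction-neighbour Cf av′ fb)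
    where
    Cf : IsFactor u C
    Cf = i , proj₁ (occ-∷ʳ⁻ a C o)

-- From a non-palindromic mirror return to a cycle.

module _ {n : ℕ} (u : InfWord n) where
  open ExtensionGraph u

  -- A cycle through `left c`, cut into its two edges at `left c` and a path avoiding `C`. Excluding
  -- the mirror image of `C` too treats `left c` and `right c` as one vertex when z is a palindrome.
  AcyclicAt : Word n → Set
  AcyclicAt z = ∀ c a b → Avoids (c ∷ z) (z ∷ʳ a) → Avoids (c ∷ z) (z ∷ʳ b) →
                IsFactor u (c ∷ z ∷ʳ a) → IsFactor u (c ∷ z ∷ʳ b) → Path z (c ∷ z) (right a) (right b) → a ≡ b

module Walk {n : ℕ} (u : InfWord n) (rc : ReversalClosed u)
  (c : Fin n) (z : Word n) (i d : ℕ)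
  (ret : Windows.MirrorReturn u (c ∷ z) i (suc (i + suc d)))
  (oC : OccursAt u (c ∷ z) i) (oC′ : OccursAt u (reverse (c ∷ z)) (suc (i + suc d)))
  (good : ∀ p q → i < p → q ≤ suc (i + suc d) → Windows.MirrorReturn u z p q →
          Windows.PalSegment u p (q + length z)) where
  open Windows u
  open ExtensionGraph u

  private
    j : ℕ
    j = suc (i + suc d)
    C : Word n
    C = c ∷ z
    a b : Fin n
    a = u (suc i + length z)
    b = u (i + suc d)
    oz : OccursAt u z (suc i)
    oz = proj₂ (occ-∷⁻ c z oC)
    oz′ : OccursAt u (reverse z) j
    oz′ = proj₁ (occ-∷ʳ⁻ c (reverse z) (subst (λ w → OccursAt u w j) (unfold-reverse c z) oC′))

  -- Reading from left to right, an occurrence of z is entered through the letter on its left,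
  -- whereas an occurrence of z̃ is entered through the letter that stands to the right of z.
  before after : ∀ {p} → MirrorOcc z p → Fin n → Vertex n
  before (inj₁ _) = left
  before (inj₂ _) = right
  after (inj₁ _) = right
  after (inj₂ _) = left

  occ-before : ∀ {q} (o : MirrorOcc z (suc q)) → MirrorOcc (ext z (before o (u q))) q
  occ-before (inj₁ o) = inj₁ (occ-∷⁺ z o)
  occ-before {q} (inj₂ o) =
      inj₂ (subst (λ w → OccursAt u w q) (sym (reverse-++ z (u q ∷ []))) (occ-∷⁺ (reverse z) o))

  occ-after : ∀ {p} (o : MirrorOcc z p) → MirrorOcc (ext z (after o (u (p + length z)))) p
  occ-after (inj₁ o) = inj₁ (occ-∷ʳ⁺ z o)
  occ-after {p} (inj₂ o) = inj₂ (subst (λ w → OccursAt u w p)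
    (trans (cong (λ l → reverse z ∷ʳ u (p + l)) (length-reverse z)) (sym (unfold-reverse (u (p + length z)) z))) (occ-∷ʳ⁺ (reverse z) o))

  avoids : ∀ {V q} → i < q → q < j → MirrorOcc V q → Avoids C V
  avoids {V} {q} x y o =
      (λ e → ¬C (subst (λ W → MirrorOcc W q) e o)) , λ e → ¬C (unreverse (subst (λ W → MirrorOcc W q) e o))
    where
    ¬C : ¬ MirrorOcc C q
    ¬C = MirrorReturn.inner ret q x y
    unreverse : MirrorOcc (reverse C) q → MirrorOcc C q
    unreverse (inj₁ o) = inj₂ o
    unreverse (inj₂ o) = inj₁ (subst (λ w → OccursAt u w q) (reverse-involutive C) o)

  crossing : ∀ {q} (o : MirrorOcc z (suc q)) → Adjacent z (before o (u q)) (after o (u (suc q + length z)))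
  crossing {q} (inj₁ o) = edge (q , occ-∷⁺ (z ∷ʳ _) (occ-∷ʳ⁺ z o))
  crossing {q} (inj₂ o) =
      edgeᵒ (subst (IsFactor u) e (rc _ (q , occ-∷⁺ (reverse z ∷ʳ _) (occ-∷ʳ⁺ (reverse z) o))))
    where
    y = u (suc q + length (reverse z))
    e : reverse (u q ∷ reverse z ∷ʳ y) ≡ u (suc q + length z) ∷ z ∷ʳ u q
    e = trans (unfold-reverse (u q) (reverse z ∷ʳ y)) (trans (cong (_∷ʳ u q) (reverse-++ (reverse z) (y ∷ [])))
      (cong₂ (λ l w → u (suc q + l) ∷ w ∷ʳ u q) (length-reverse z) (reverse-involutive z)))

  opposite : ∀ {p q} → PalSegment p (suc q + length z) → p ≤ q → (o : MirrorOcc z (suc q)) →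
             ∃ λ (o′ : MirrorOcc z p) → ∀ y → before o y ≡ after o′ y
  opposite {p} {q} seg p≤q (inj₁ o) = inj₂ (occ-reflect z seg
      (≡-solve (q ∷ p ∷ length z ∷ []) λ q p |z| → lit 1 ⊞ q ⊞ p ⊞ |z| ≼
      p ⊞ (lit 1 ⊞ q ⊞ |z|)) (m≤n⇒m≤1+n p≤q) ≤-refl o) , λ y → refl
  opposite {p} {q} seg p≤q (inj₂ o) = inj₁ (subst (λ w → OccursAt u w p) (reverse-involutive z)
    (occ-reflect (reverse z) seg (lin≡ (length-reverse z)
        (≡-solve (q ∷ p ∷ length (reverse z) ∷ length z ∷ [])
        λ q p |reversez| |z| → lit 1 ⊞ q ⊞ p ⊞ |reversez| ⊞ |z| ≼
        p ⊞ (lit 1 ⊞ q ⊞ |z|) ⊞ |reversez|)) (m≤n⇒m≤1+n p≤q) ≤-refl o)) , λ y → refl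

  -- The word z itself occurs at `suc i`. If z̃ occurs there as well, then z is a palindrome and a
  -- flip edge leads from `right a` to `left a`.
  first-step : (o : MirrorOcc z (suc i)) → Path z C (right a) (after o a)
  first-step (inj₁ _) = ε
  first-step o@(inj₂ o′) = (avoids ≤-refl
      (≤-solve (i ∷ d ∷ []) λ i d → lit 1 ⊞ (lit 1 ⊞ i) ≼
      lit 1 ⊞ (i ⊞ (lit 1 ⊞ d))) (occ-after (inj₁ oz)) , avoids ≤-refl
      (≤-solve (i ∷ d ∷ []) λ i d → lit 1 ⊞ (lit 1 ⊞ i) ≼ lit 1 ⊞ (i ⊞ (lit 1 ⊞ d))) (occ-after o) ,
    flipᵒ (trans (sym oz) (trans (cong (λ l → u [ suc i , l ]) (sym (length-reverse z))) o′))) ◅ ε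

  -- Induction on the occurrences of z and z̃. The palindromic return ending at `suc q` makes the
  -- vertex entered there the same as the one left at the preceding occurrence `suc p`, and crossing
  -- the occurrence at `suc p` is an edge.
  walk : ∀ fuel q → q ≤ fuel → i < q → suc q ≤ j → (o : MirrorOcc z (suc q)) →
         Path z C (right a) (before o (u q))
  walk zero .0 z≤n () _ _
  walk (suc fuel) q q≤ i<q q<j o with last-before (mirrorOcc? z) (suc i) (suc q) (s≤s i<q) (inj₁ oz)
  ... | suc p , s≤s i≤p , s≤s p<q , op , none = arrive (opposite seg p<q o) (m≤n⇒m<n∨m≡n i≤p)
    where
    seg : PalSegment (suc p) (suc q + length z)
    seg = good (suc p) (suc q) (s≤s i≤p) q<j (mirrorReturn (s≤s p<q) op o none)
    letter : u (suc p + length z) ≡ u q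
    letter = seg (suc p + length z) q
        (≤-solve (p ∷ length z ∷ []) λ p |z| → lit 1 ⊞ p ≼ lit 1 ⊞ p ⊞ |z|) p<q
        (≡-solve (p ∷ length z ∷ q ∷ []) λ p |z| q → lit 1 ⊞ (lit 1 ⊞ p ⊞ |z| ⊞ q) ≼
        lit 1 ⊞ p ⊞ (lit 1 ⊞ q ⊞ |z|))
    path-after : i < p ⊎ i ≡ p → (o′ : MirrorOcc z (suc p)) →
        Path z C (right a) (after o′ (u (suc p + length z)))
    path-after (inj₂ refl) o′ = first-step o′
    path-after (inj₁ i<p) o′ = walk fuel p (lin (p<q ⊕ q≤)
        (≤-solve (p ∷ q ∷ fuel ∷ []) λ p q fuel → p ⊞ (q ⊞ (lit 1 ⊞ fuel)) ≼
        fuel ⊞ (lit 1 ⊞ p ⊞ q))) i<p (lin (p<q ⊕ q<j)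
        (≤-solve (p ∷ q ∷ i ∷ d ∷ []) λ p q i d → lit 1 ⊞ (p ⊞ (q ⊞ (lit 1 ⊞ (i ⊞ (lit 1 ⊞ d))))) ≼
        lit 1 ⊞ (i ⊞ (lit 1 ⊞ d) ⊞ (lit 1 ⊞ (p ⊞ (lit 1 ⊞ q)))))) o′ ◅◅
      (avoids i<p (lin (p<q ⊕ q<j)
          (≤-solve (p ∷ q ∷ i ∷ d ∷ []) λ p q i d → lit 1 ⊞ (p ⊞ (q ⊞ (lit 1 ⊞ (i ⊞ (lit 1 ⊞ d))))) ≼
          lit 1 ⊞ (i ⊞ (lit 1 ⊞ d) ⊞ (lit 1 ⊞ (p ⊞ (lit 1 ⊞ q)))))) (occ-before o′) , avoids (m≤n⇒m≤1+n i<p) (lin (p<q ⊕ q<j)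
          (≤-solve (p ∷ q ∷ i ∷ d ∷ [])
          λ p q i d → lit 1 ⊞ (lit 1 ⊞ (p ⊞ (q ⊞ (lit 1 ⊞ (i ⊞ (lit 1 ⊞ d)))))) ≼
          lit 1 ⊞ (i ⊞ (lit 1 ⊞ d) ⊞ (lit 1 ⊞ (p ⊞ (lit 1 ⊞ q)))))) (occ-after o′) , crossing o′) ◅ ε
    arrive : (∃ λ (o′ : MirrorOcc z (suc p)) → ∀ y → before o y ≡ after o′ y) → i < p ⊎ i ≡ p →
        Path z C (right a) (before o (u q))
    arrive (o′ , e) cmp =
        subst (Path z C (right a)) (trans (cong (after o′) letter) (sym (e (u q)))) (path-after cmp o′)

  conclude : AcyclicAt u z → a ≡ b
  conclude acyc = acyc c a b (avoids ≤-refl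
      (≤-solve (i ∷ d ∷ []) λ i d → lit 1 ⊞ (lit 1 ⊞ i) ≼
      lit 1 ⊞ (i ⊞ (lit 1 ⊞ d))) (occ-after (inj₁ oz))) (avoids
      (≤-solve (i ∷ d ∷ []) λ i d → lit 1 ⊞ i ≼ i ⊞ (lit 1 ⊞ d)) ≤-refl (occ-before (inj₂ oz′)))
    (i , occ-a) (subst (IsFactor u) e (rc _ (i + suc d , occ-∷⁺ (reverse z ∷ʳ c) (subst (λ w → OccursAt u w j) (unfold-reverse c z) oC′))))
    (walk (i + suc d) (i + suc d) ≤-refl
        (≤-solve (i ∷ d ∷ []) λ i d → lit 1 ⊞ i ≼ i ⊞ (lit 1 ⊞ d)) ≤-refl (inj₂ oz′))
    where
    occ-a : OccursAt u (c ∷ z ∷ʳ a) i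
    occ-a = subst (λ k → OccursAt u (C ∷ʳ u k) i) (+-suc i (length z)) (occ-∷ʳ⁺ C oC)
    e : reverse (b ∷ reverse z ∷ʳ c) ≡ c ∷ z ∷ʳ b
    e = trans (unfold-reverse b (reverse z ∷ʳ c)) (trans (cong (_∷ʳ b) (reverse-++ (reverse z) (c ∷ [])))
      (cong (λ w → c ∷ w ∷ʳ b) (reverse-involutive z)))

module Returns {n : ℕ} (u : InfWord n) (rc : ReversalClosed u)
  (acyclic : ∀ z → z ≢ [] → AcyclicAt u z)
  (letters : AcyclicAt u [] ⊎ (∀ c → Windows.PalReturns u (c ∷ []))) where
  open Windows u

  PalShorter : ℕ → Set
  PalShorter m = ∀ x p q → x ≢ [] → q + length x < p + m → MirrorReturn x p q → PalSegment p (q + length x)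

  mirrorReturn-[] : ∀ {p q} → MirrorReturn [] p q → PalSegment p (q + 0)
  mirrorReturn-[] {p} {q} ret = subst (PalSegment p) (≤-antisym (lin i<j
      (≤-solve (p ∷ q ∷ []) λ p q → p ⊞ lit 1 ⊞ q ≼ q ⊞ lit 0 ⊞ (lit 1 ⊞ p))) (lin q≤
      (≤-solve (q ∷ p ∷ []) λ q p → q ⊞ lit 0 ⊞ (lit 1 ⊞ p) ≼ p ⊞ lit 1 ⊞ q))) (palSegment-letter p)
    where
    open MirrorReturn ret
    q≤ : q ≤ suc p
    q≤ = ≮⇒≥ (λ lt → inner (suc p) ≤-refl lt (inj₁ refl))

  -- If the letter after the first end equals the one before the last end, it is absorbed into X,
  -- which leaves the segment unchanged and lowers `d`. At `d` = 0 the ends are one position apart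
  -- and determine the whole segment. Distinct letters give the situation c z a ... b z̃ c, refuted
  -- by the walk unless z is empty and the returns to letters are palindromes by assumption.
  opposite-ends : ∀ d X {i} → X ≢ [] → OccursAt u X i → OccursAt u (reverse X) (suc (i + d)) →
    MirrorReturn X i (suc (i + d)) → PalShorter (suc (d + length X)) → PalSegment i (suc (i + d) + length X)
  opposite-ends d [] ne _ _ _ _ = ⊥-elim (ne refl)
  opposite-ends zero X@(_ ∷ xs) {i} _ o o′ ret ih s t x y e with m≤n⇒m<n∨m≡n y
  ... | inj₁ y′ =
      reverse-win⁻ (length X) i (suc (i + 0)) flip s t x (≤-trans (≡⇒≤ (cong suc (+-identityʳ i))) y′) (lin≡ e
      (≡-solve (s ∷ t ∷ i ∷ length xs ∷ [])
      λ s t i |xs| → lit 1 ⊞ (s ⊞ t ⊞ (i ⊞ (lit 1 ⊞ (i ⊞ lit 0 ⊞ (lit 1 ⊞ |xs|))))) ≼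
      i ⊞ (lit 1 ⊞ (i ⊞ lit 0)) ⊞ (lit 1 ⊞ |xs|) ⊞ (lit 1 ⊞ (s ⊞ t))))
    where
    flip : reverse (u [ i , length X ]) ≡ u [ suc (i + 0) , length X ]
    flip = trans (cong reverse o) (trans (sym o′) (cong (λ l → u [ suc (i + 0) , l ]) (length-reverse X)))
  ... | inj₂ refl = sym (reverse-win⁻ (length X) i (suc (i + 0)) flip t s y (lin (≡⇒≥ e)
      (≤-solve (i ∷ s ∷ length xs ∷ []) λ i s |xs| → lit 1 ⊞ (i ⊞ lit 0) ⊞ (lit 1 ⊞ (s ⊞ i)) ≼
      s ⊞ (i ⊞ (lit 1 ⊞ (i ⊞ lit 0 ⊞ (lit 1 ⊞ |xs|)))))) (lin≡ e
      (≡-solve (i ∷ s ∷ length xs ∷ [])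
      λ i s |xs| → lit 1 ⊞ (i ⊞ s ⊞ (i ⊞ (lit 1 ⊞ (i ⊞ lit 0 ⊞ (lit 1 ⊞ |xs|))))) ≼
      i ⊞ (lit 1 ⊞ (i ⊞ lit 0)) ⊞ (lit 1 ⊞ |xs|) ⊞ (lit 1 ⊞ (s ⊞ i)))))
    where
    flip : reverse (u [ i , length X ]) ≡ u [ suc (i + 0) , length X ]
    flip = trans (cong reverse o) (trans (sym o′) (cong (λ l → u [ suc (i + 0) , l ]) (length-reverse X)))
  opposite-ends (suc d) X@(c ∷ z) {i} ne o o′ ret ih = branch (u (suc i + length z) ≟ᶠ u (i + suc d))
    where
    grow : u (suc i + length z) ≡ u (i + suc d) → PalSegment i (suc (i + suc d) + length X)
    grow e = subst (PalSegment i) (lin≡ (length-++ z {u (suc i + length z) ∷ []})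
        (≡-solve (i ∷ d ∷ length (z ++ u (suc (i + length z)) ∷ []) ∷ length z ∷ [])
        λ i d |za| |z| → lit 1 ⊞ (i ⊞ d ⊞ (lit 1 ⊞ |za|) ⊞ (|z| ⊞ lit 1)) ≼
        lit 1 ⊞ (i ⊞ (lit 1 ⊞ d) ⊞ (lit 1 ⊞ |z|) ⊞ |za|)))
      (opposite-ends d X′ (λ ()) oX oX′
        (mirrorReturn (≤-solve (i ∷ d ∷ []) λ i d → lit 1 ⊞ i ≼ lit 1 ⊞ (i ⊞ d)) (inj₁ oX) (inj₂ oX′) inner′)
        (λ x p q ne lt r → ih x p q ne (lin (lt ⊕ ≡⇒≤ (length-++ z {u (suc i + length z) ∷ []}))
            (≤-solve (q ∷ length x ∷ p ∷ d ∷ length (z ++ u (suc (i + length z)) ∷ []) ∷ length z ∷ [])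
            λ q |x| p d |za| |z| → lit 1 ⊞ (q ⊞ |x| ⊞ (p ⊞ (lit 1 ⊞ (d ⊞ (lit 1 ⊞ |za|))) ⊞ (|z| ⊞ lit 1))) ≼
            p ⊞ (lit 1 ⊞ (lit 1 ⊞ (d ⊞ (lit 1 ⊞ |z|)))) ⊞ (lit 1 ⊞ (q ⊞ |x| ⊞ |za|)))) r))
      where
      X′ : Word n
      X′ = X ∷ʳ u (suc i + length z)
      rev-X′ : reverse X′ ≡ u (suc i + length z) ∷ reverse X
      rev-X′ = reverse-++ X (u (suc i + length z) ∷ [])
      oX : OccursAt u X′ i
      oX = subst (λ k → OccursAt u (X ∷ʳ u k) i) (+-suc i (length z)) (occ-∷ʳ⁺ X o)
      oX′ : OccursAt u (reverse X′) (suc (i + d))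
      oX′ =
          subst₂ (λ w k → OccursAt u w k) (trans (cong (_∷ reverse X) (sym e)) (sym rev-X′)) (+-suc i d) (occ-∷⁺ (reverse X) o′)
      inner′ : ∀ k → i < k → k < suc (i + d) → ¬ MirrorOcc X′ k
      inner′ k x y (inj₁ w) = MirrorReturn.inner ret k x (lin y
          (≤-solve (k ∷ i ∷ d ∷ []) λ k i d → lit 1 ⊞ k ⊞ (lit 1 ⊞ (i ⊞ d)) ≼
          lit 1 ⊞ (i ⊞ (lit 1 ⊞ d)) ⊞ (lit 1 ⊞ k))) (inj₁ (proj₁ (occ-∷ʳ⁻ _ X w)))
      inner′ k x y (inj₂ w) = MirrorReturn.inner ret (suc k) (m≤n⇒m≤1+n x) (lin y
          (≤-solve (k ∷ i ∷ d ∷ []) λ k i d → lit 1 ⊞ (lit 1 ⊞ k) ⊞ (lit 1 ⊞ (i ⊞ d)) ≼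
          lit 1 ⊞ (i ⊞ (lit 1 ⊞ d)) ⊞ (lit 1 ⊞ k)))
        (inj₂ (proj₂ (occ-∷⁻ _ (reverse X) (subst (λ w → OccursAt u w k) rev-X′ w))))
    turn : ∀ z → (ret : MirrorReturn (c ∷ z) i (suc (i + suc d))) → OccursAt u (c ∷ z) i →
        OccursAt u (reverse (c ∷ z)) (suc (i + suc d)) →
           PalShorter (suc (suc d + length (c ∷ z))) → u (suc i + length z) ≢ u (i + suc d) → PalSegment i (suc (i + suc d) + length (c ∷ z))
    turn [] ret o o′ ih ≢ =
      [ (λ acyc → ⊥-elim (≢ (Walk.conclude u rc c [] i d ret o o′ (λ p q _ _ r → mirrorReturn-[] r) acyc)))
      , (λ pal → pal c i _ ret) ]′ letters
    turn z@(_ ∷ xs) ret o o′ ih ≢ = ⊥-elim (≢ (Walk.conclude u rc c z i d ret o o′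
      (λ p q i<p q≤ r → ih z p q (λ ()) (lin (i<p ⊕ q≤)
          (≤-solve (q ∷ length xs ∷ p ∷ i ∷ d ∷ [])
          λ q |xs| p i d → lit 1 ⊞ (q ⊞ (lit 1 ⊞ |xs|) ⊞ (p ⊞ (lit 1 ⊞ (i ⊞ (lit 1 ⊞ d))))) ≼
          p ⊞ (lit 1 ⊞ (lit 1 ⊞ (d ⊞ (lit 1 ⊞ (lit 1 ⊞ |xs|))))) ⊞ (lit 1 ⊞ (i ⊞ q)))) r) (acyclic z (λ ()))))
    branch : Dec (u (suc i + length z) ≡ u (i + suc d)) → PalSegment i (suc (i + suc d) + length X)
    branch (yes e) = grow e
    branch (no ≢) = turn z ret o o′ ih ≢

  mirror-ends : ∀ X {i j} → X ≢ [] → OccursAt u X i → OccursAt u (reverse X) j → MirrorReturn X i j →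
                PalShorter ((j ∸ i) + length X) → PalSegment i (j + length X)
  mirror-ends X {i} ne o o′ ret ih with m≤n⇒∃[o]m+o≡n (MirrorReturn.i<j ret)
  ... | d , refl = opposite-ends d X ne o o′ ret (λ y p q ne′ lt → ih y p q ne′
    (lin (lt ⊕ ≡⇒≥ (trans (cong (_∸ i) (sym (+-suc i d))) (m+n∸m≡n i (suc d))))
        (≤-solve (q ∷ length y ∷ p ∷ d ∷ length X ∷ (suc (i + d) ∸ i) ∷ [])
        λ q |y| p d |X| δ → lit 1 ⊞ (q ⊞ |y|) ⊞ (p ⊞ (lit 1 ⊞ (d ⊞ |X|)) ⊞ δ) ≼
        p ⊞ (δ ⊞ |X|) ⊞ (lit 1 ⊞ (q ⊞ |y|) ⊞ (lit 1 ⊞ d)))))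

  -- For x = yd, the return to y starting at `i` is shorter, hence palindromic, and reflects x to an
  -- occurrence of x̃ at some `k` with i ≤ k < j. If k > i this is a forbidden inner occurrence; if
  -- k = i it makes x a palindrome.
  same-ends : ∀ x {i j} → ¬ Palindrome x → OccursAt u x i → OccursAt u x j → MirrorReturn x i j →
              PalShorter ((j ∸ i) + length x) → ⊥
  same-ends x np o o′ ret ih with initLast x
  ... | [] = np refl
  ... | [] ∷ʳ′ d = np refl
  same-ends x {i} {j} np o o′ ret ih | y@(_ ∷ xs) ∷ʳ′ d
    with first-between (mirrorOcc? y) (suc i) j (MirrorReturn.i<j ret) (inj₁ (proj₁ (occ-∷ʳ⁻ d y o′)))
  ... | suc k , s≤s i≤k , k<j , ok , none = split (m≤n⇒m<n∨m≡n i≤k)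
    where
    seg : PalSegment i (suc k + length y)
    seg =
        ih y i (suc k) (λ ()) (lin (k<j ⊕ ≡⇒≥ (m+[n∸m]≡n (<⇒≤ (MirrorReturn.i<j ret))) ⊕ ≡⇒≥ (length-++ y {d ∷ []}))
        (≤-solve (k ∷ length xs ∷ j ∷ i ∷ (j ∸ i) ∷ length (xs ++ d ∷ []) ∷ [])
        λ k |xs| j i δ |xsd| → lit 1 ⊞ (lit 1 ⊞ (k ⊞ (lit 1 ⊞ |xs|) ⊞ (j ⊞ (i ⊞ δ ⊞ (lit 1 ⊞ |xsd|))))) ≼
        i ⊞ (δ ⊞ (lit 1 ⊞ |xsd|)) ⊞ (lit 1 ⊞ (k ⊞ (j ⊞ (lit 1 ⊞ (|xs| ⊞ lit 1)))))))
      (mirrorReturn (s≤s i≤k) (inj₁ (proj₁ (occ-∷ʳ⁻ d y o))) ok none)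
    o″ : OccursAt u (reverse (y ∷ʳ d)) k
    o″ = occ-reflect (y ∷ʳ d) seg (lin≡ (length-++ y {d ∷ []})
        (≡-solve (i ∷ k ∷ length (xs ++ d ∷ []) ∷ length xs ∷ [])
        λ i k |xsd| |xs| → i ⊞ k ⊞ (lit 1 ⊞ |xsd|) ⊞ (lit 1 ⊞ (|xs| ⊞ lit 1)) ≼
        i ⊞ (lit 1 ⊞ (k ⊞ (lit 1 ⊞ |xs|))) ⊞ (lit 1 ⊞ |xsd|))) ≤-refl i≤k o
    split : i < k ⊎ i ≡ k → ⊥
    split (inj₁ i<k) = MirrorReturn.inner ret k i<k k<j (inj₂ o″)
    split (inj₂ refl) =
        np (trans (sym o) (trans (cong (λ l → u [ i , l ]) (sym (length-reverse (y ∷ʳ d)))) o″))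

  palReturns-bounded : ∀ fuel x i j → x ≢ [] → j + length x < i + fuel → MirrorReturn x i j →
      PalSegment i (j + length x)
  palReturns-bounded zero x i j ne lt ret = ⊥-elim (lin⊥ (lt ⊕ MirrorReturn.i<j ret)
      (≤-solve (i ∷ j ∷ length x ∷ []) λ i j |x| → lit 1 ⊞ (i ⊞ lit 0 ⊞ j) ≼ lit 1 ⊞ (j ⊞ |x|) ⊞ (lit 1 ⊞ i)))
  palReturns-bounded (suc fuel) x i j ne lt ret = cases (MirrorReturn.start ret) (MirrorReturn.end ret)
    where
    open MirrorReturn ret using (i<j)
    shorter : ∀ X → length X ≡ length x → PalShorter ((j ∸ i) + length X)
    shorter X e y p q ne′ lt′ = palReturns-bounded fuel y p q ne′
      (lin (lt ⊕ lt′ ⊕ ≡⇒≤ e ⊕ ≡⇒≤ (m+[n∸m]≡n (<⇒≤ i<j)))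
          (≤-solve (q ∷ length y ∷ i ∷ fuel ∷ p ∷ (j ∸ i) ∷ length X ∷ length x ∷ j ∷ [])
          λ q |y| i fuel p δ |X| |x| j → lit 1 ⊞ (q ⊞ |y|) ⊞ (i ⊞ (lit 1 ⊞ fuel) ⊞ (p ⊞ (δ ⊞ |X|) ⊞ (|x| ⊞ j))) ≼ p ⊞ fuel ⊞ (lit 1 ⊞ (j ⊞ |x|) ⊞ (lit 1 ⊞ (q ⊞ |y|) ⊞ (|X| ⊞ (i ⊞ δ))))))
    opp : ∀ X → X ≢ [] → length X ≡ length x → OccursAt u X i → OccursAt u (reverse X) j →
        MirrorReturn X i j → PalSegment i (j + length x)
    opp X ne e o o′ r = subst (λ l → PalSegment i (j + l)) e (mirror-ends X ne o o′ r (shorter X e))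
    same : ∀ X → ¬ Palindrome X → length X ≡ length x → OccursAt u X i → OccursAt u X j →
        MirrorReturn X i j → ⊥
    same X np e o o′ r = same-ends X np o o′ r (shorter X e)
    rne : reverse x ≢ []
    rne e = ne (reverse-injective e)
    cases : MirrorOcc x i → MirrorOcc x j → PalSegment i (j + length x)
    cases (inj₁ o) (inj₂ o′) = opp x ne refl o o′ ret
    cases (inj₂ o) (inj₁ o′) = opp (reverse x) rne (length-reverse x) o
      (subst (λ w → OccursAt u w j) (sym (reverse-involutive x)) o′) (mirrorReturn-reverse x ret)
    cases (inj₁ o) (inj₁ o′) with palindrome? x
    ... | yes p = opp x ne refl o (subst (λ w → OccursAt u w j) p o′) ret
    ... | no np = ⊥-elim (same x np refl o o′ ret)
    cases (inj₂ o) (inj₂ o′) with palindrome? (reverse x)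
    ... | yes p =
        opp (reverse x) rne (length-reverse x) o (subst (λ w → OccursAt u w j) p o′) (mirrorReturn-reverse x ret)
    ... | no np = ⊥-elim (same (reverse x) np (length-reverse x) o o′ (mirrorReturn-reverse x ret))

  palReturns : ∀ x → x ≢ [] → PalReturns x
  palReturns x ne i j ret = palReturns-bounded (suc (j + length x)) x i j ne
      (≤-solve (j ∷ length x ∷ i ∷ []) λ j |x| i → lit 1 ⊞ (j ⊞ |x|) ≼ i ⊞ (lit 1 ⊞ (j ⊞ |x|))) ret

-- Powers of a morphism and uniform recurrence of primitive fixed points.

module _ {n : ℕ} where

  infixr 9 _⊙_
  _⊙_ : Morphism n → Morphism n → Morphism n
  (φ ⊙ ψ) a = φ ⋆ ψ a

  ⋆-++ : ∀ (φ : Morphism n) v w → φ ⋆ (v ++ w) ≡ φ ⋆ v ++ φ ⋆ w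
  ⋆-++ φ = concatMap-++ φ

  ⋆-letter : ∀ (φ : Morphism n) a → φ ⋆ (a ∷ []) ≡ φ a
  ⋆-letter φ a = ++-identityʳ (φ a)

  ⊙-⋆ : ∀ (φ ψ : Morphism n) w → (φ ⊙ ψ) ⋆ w ≡ φ ⋆ (ψ ⋆ w)
  ⊙-⋆ φ ψ [] = refl
  ⊙-⋆ φ ψ (a ∷ w) = trans (cong (φ ⋆ ψ a ++_) (⊙-⋆ φ ψ w)) (sym (⋆-++ φ (ψ a) (ψ ⋆ w)))

  pow : Morphism n → ℕ → Morphism n
  pow φ k a = fold (a ∷ []) (φ ⋆_) k

  pow-+ : ∀ φ k l a → pow φ (k + l) a ≡ pow φ k ⋆ pow φ l a
  pow-+ φ zero l a = sym (concatMap-pure (pow φ l a))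
  pow-+ φ (suc k) l a = trans (cong (φ ⋆_) (pow-+ φ k l a)) (sym (⊙-⋆ φ (pow φ k) (pow φ l a)))

  length-⋆ : ∀ {φ : Morphism n} {k} → (∀ a → k ≤ length (φ a)) → ∀ w → length w * k ≤ length (φ ⋆ w)
  length-⋆ h [] = z≤n
  length-⋆ {φ} h (a ∷ w) = ≤-trans (+-mono-≤ (h a) (length-⋆ h w)) (≤-reflexive (sym (length-++ (φ a))))

  length-⋆-≥ : ∀ {φ : Morphism n} → (∀ a → 1 ≤ length (φ a)) → ∀ w → length w ≤ length (φ ⋆ w)
  length-⋆-≥ h w = ≤-trans (≤-reflexive (sym (*-identityʳ (length w)))) (length-⋆ h w)

  infix-⋆ : ∀ (φ : Morphism n) {q w} → Infix q w → Infix (φ ⋆ q) (φ ⋆ w)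
  infix-⋆ φ {q} (v , v′ , refl) = φ ⋆ v , φ ⋆ v′ , trans (⋆-++ φ v (q ++ v′)) (cong (φ ⋆ v ++_) (⋆-++ φ q v′))

  infix-trans : ∀ {q w t : Word n} → Infix q w → Infix w t → Infix q t
  infix-trans {q} (v , v′ , refl) (x , x′ , refl) = x ++ v , v′ ++ x′ , (begin
    x ++ (v ++ q ++ v′) ++ x′    ≡⟨ cong (x ++_) (++-assoc v (q ++ v′) x′) ⟩
    x ++ v ++ (q ++ v′) ++ x′    ≡⟨ sym (++-assoc x v _) ⟩
    (x ++ v) ++ (q ++ v′) ++ x′  ≡⟨ cong ((x ++ v) ++_) (++-assoc q v′ x′) ⟩
    (x ++ v) ++ q ++ v′ ++ x′    ∎)
    where open ≡-Reasoning

  letter-infix : ∀ {a : Fin n} {w} → a ∈ w → Infix (a ∷ []) w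
  letter-infix a∈ = ∈-∃++ a∈

two-letters : ∀ {n} {x y : Fin n} {w} → x ≢ y → x ∈ w → y ∈ w → 2 ≤ length w
two-letters ne (here refl) (here refl) = ⊥-elim (ne refl)
two-letters {w = _ ∷ _ ∷ _} ne (here _) (there _) = s≤s (s≤s z≤n)
two-letters {w = _ ∷ _ ∷ _} ne (there _) _ = s≤s (s≤s z≤n)

unary-power : (w : Word 1) → w ≡ concat (replicate (length w) (Fin.zero ∷ []))
unary-power [] = refl
unary-power (Fin.zero ∷ w) = cong (Fin.zero ∷_) (unary-power w)

distinct-letters : ∀ {n} (φ : Morphism n) → InfWord n → Acyclic φ → ∃₂ λ (x y : Fin n) → x ≢ y
distinct-letters {zero} φ u ac with u 0
... | ()
distinct-letters {suc zero} φ u ac = ⊥-elim (ac (Fin.zero ∷ [] , λ a → length (φ a) , unary-power (φ a)))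
distinct-letters {suc (suc n)} φ u ac = Fin.zero , Fin.suc Fin.zero , λ ()

bounded : ∀ {n} (f : Fin n → ℕ) → ∃ λ B → ∀ a → f a ≤ B
bounded {zero} f = 0 , λ ()
bounded {suc n} f = let (B , h) = bounded (λ a → f (Fin.suc a)) in
  f Fin.zero + B , λ { Fin.zero → m≤m+n _ B ; (Fin.suc a) → ≤-trans (h a) (m≤n+m B (f Fin.zero)) }

module Images {n : ℕ} (u : InfWord n) where
  open Windows u

  Fixes : Morphism n → Set
  Fixes θ = ∀ l → θ ⋆ (u [ 0 , l ]) ≡ u [ 0 , length (θ ⋆ (u [ 0 , l ])) ]

  factor-infix : ∀ {q w} → Infix q w → IsFactor u w → IsFactor u q
  factor-infix {q} (v , v′ , refl) (i , o) =
      i + length v , proj₁ (occ-++⁻ q v′ (proj₂ (occ-++⁻ v (q ++ v′) o)))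

  take-++ˡ : ∀ {A : Set} (v w : List A) → take (length v) (v ++ w) ≡ v
  take-++ˡ [] w = refl
  take-++ˡ (a ∷ v) w = cong (a ∷_) (take-++ˡ v w)

  -- `FixedPoint` supplies some prefix whose image is long enough. If it is shorter than `l`,
  -- comparing lengths shows that the letters in between have empty images.
  fixed-prefix : ∀ {φ} → FixedPoint φ u → Fixes φ
  fixed-prefix {φ} fp l with fp (length (φ ⋆ (u [ 0 , l ])))
  ... | l′ , e with ≤-total l l′
  ... | inj₁ le with m≤n⇒∃[o]m+o≡n le
  ... | r , refl = trans (sym (take-++ˡ (φ ⋆ (u [ 0 , l ])) (φ ⋆ (u [ l , r ]))))
      (trans (cong (take (length (φ ⋆ (u [ 0 , l ])))) (trans (sym (⋆-++ φ (u [ 0 , l ]) (u [ l , r ]))) (cong (φ ⋆_) (sym (win-++ 0 l r))))) e)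
  fixed-prefix {φ} fp l | l′ , e | inj₂ le with m≤n⇒∃[o]m+o≡n le
  ... | r , refl =
      subst (λ w → w ≡ u [ 0 , length w ]) (sym (trans split (trans (cong (φ ⋆ (u [ 0 , l′ ]) ++_) rest) (++-identityʳ _)))) short
    where
    split : φ ⋆ (u [ 0 , l′ + r ]) ≡ φ ⋆ (u [ 0 , l′ ]) ++ φ ⋆ (u [ l′ , r ])
    split = trans (cong (φ ⋆_) (win-++ 0 l′ r)) (⋆-++ φ (u [ 0 , l′ ]) (u [ l′ , r ]))
    len : length (φ ⋆ (u [ 0 , l′ + r ])) ≡ length (φ ⋆ (u [ 0 , l′ ])) + length (φ ⋆ (u [ l′ , r ]))
    len = trans (cong length split) (length-++ (φ ⋆ (u [ 0 , l′ ])))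
    full : take (length (φ ⋆ (u [ 0 , l′ + r ]))) (φ ⋆ (u [ 0 , l′ ])) ≡ φ ⋆ (u [ 0 , l′ ])
    full = take-all _ _ (≤-trans (m≤m+n _ _) (≤-reflexive (sym len)))
    e′ : φ ⋆ (u [ 0 , l′ ]) ≡ u [ 0 , length (φ ⋆ (u [ 0 , l′ + r ])) ]
    e′ = trans (sym full) e
    len′ : length (φ ⋆ (u [ 0 , l′ ])) ≡ length (φ ⋆ (u [ 0 , l′ + r ]))
    len′ = trans (cong length e′) (length-win 0 _)
    rest : φ ⋆ (u [ l′ , r ]) ≡ []
    rest with φ ⋆ (u [ l′ , r ]) in eq
    ... | [] = refl
    ... | x ∷ xs = ⊥-elim (shift len len′ (cong length eq))
      where
      shift : ∀ {a b c} → a ≡ b + c → b ≡ a → c ≡ suc (length xs) → ⊥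
      shift {a} {b} {c} p q r = lin⊥ (≡⇒≥ p ⊕ ≡⇒≥ q ⊕ ≡⇒≥ r)
          (≤-solve (a ∷ b ∷ c ∷ length xs ∷ []) λ a b c |xs| → lit 1 ⊞ (a ⊞ (b ⊞ c)) ≼
          b ⊞ c ⊞ (a ⊞ (lit 1 ⊞ |xs|)))
    short : φ ⋆ (u [ 0 , l′ ]) ≡ u [ 0 , length (φ ⋆ (u [ 0 , l′ ])) ]
    short = trans e′ (cong (λ m → u [ 0 , m ]) (sym len′))

  fixes-pow : ∀ {φ} → Fixes φ → ∀ k → Fixes (pow φ k)
  fixes-pow {φ} h zero l = trans e (cong (λ m → u [ 0 , m ]) (sym (trans (cong length e) (length-win 0 l))))
    where
    e : pow φ 0 ⋆ (u [ 0 , l ]) ≡ u [ 0 , l ]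
    e = concatMap-pure (u [ 0 , l ])
  fixes-pow {φ} h (suc k) l =
      subst (λ w → w ≡ u [ 0 , length w ]) (sym e) (h (length (pow φ k ⋆ (u [ 0 , l ]))))
    where
    e : pow φ (suc k) ⋆ (u [ 0 , l ]) ≡ φ ⋆ (u [ 0 , length (pow φ k ⋆ (u [ 0 , l ])) ])
    e = trans (⊙-⋆ φ (pow φ k) (u [ 0 , l ])) (cong (φ ⋆_) (fixes-pow h k l))

  image-occ : ∀ {θ} → Fixes θ → ∀ {w i} → OccursAt u w i → OccursAt u (θ ⋆ w) (length (θ ⋆ (u [ 0 , i ])))
  image-occ {θ} h {w} {i} o = proj₂ (occ-++⁻ (θ ⋆ (u [ 0 , i ])) (θ ⋆ w)
    (sym (subst (λ x → x ≡ u [ 0 , length x ]) e (h (i + length w)))))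
    where
    e : θ ⋆ (u [ 0 , i + length w ]) ≡ θ ⋆ (u [ 0 , i ]) ++ θ ⋆ w
    e = trans (cong (θ ⋆_) (trans (win-++ 0 i (length w)) (cong (u [ 0 , i ] ++_) o))) (⋆-++ θ (u [ 0 , i ]) w)

  -- Cut u into the blocks θ(u l), of length at most `B`: some block begins between p and p + B, and
  -- `w` lies inside it.
  occ-in-image : ∀ {θ} → Fixes θ → (∀ a → 1 ≤ length (θ a)) → ∀ w → (∀ b → Infix w (θ b)) →
                 ∃ λ G → ∀ p → ∃ λ q → p ≤ q × q + length w ≤ p + G × OccursAt u w q
  occ-in-image {θ} fix ne w inf with bounded (λ a → length (θ a))
  ... | B , bound = B + B , λ p → locate p (first-between (λ l → p ≤? pos l) 0 p z≤n
      (≤-trans (≤-reflexive (sym (length-win 0 p))) (length-⋆-≥ ne (u [ 0 , p ]))))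
    where
    pos : ℕ → ℕ
    pos l = length (θ ⋆ (u [ 0 , l ]))
    pos-suc : ∀ l → pos (suc l) ≡ pos l + length (θ (u l))
    pos-suc l = trans (cong length (trans (cong (θ ⋆_) (win-∷ʳ 0 l)) (trans (⋆-++ θ (u [ 0 , l ]) (u l ∷ []))
      (cong (θ ⋆ (u [ 0 , l ]) ++_) (⋆-letter θ (u l)))))) (length-++ (θ ⋆ (u [ 0 , l ])))
    near : ∀ p l → (∀ k → 0 ≤ k → k < l → ¬ p ≤ pos k) → pos l ≤ p + B
    near p zero h = z≤n
    near p (suc l) h = combine (pos-suc l) (≰⇒> (h l z≤n ≤-refl)) (bound (u l))
      where
      combine : ∀ {a b c} → a ≡ b + c → suc b ≤ p → c ≤ B → a ≤ p + B
      combine {a} {b} {c} e f g = lin (≡⇒≤ e ⊕ f ⊕ g)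
          (≤-solve (a ∷ b ∷ c ∷ p ∷ B ∷ []) λ a b c p B → a ⊞ (b ⊞ c ⊞ (p ⊞ B)) ≼
          p ⊞ B ⊞ (a ⊞ (lit 1 ⊞ b ⊞ c)))
    locate : ∀ p → (∃ λ l → 0 ≤ l × l ≤ p × p ≤ pos l × (∀ k → 0 ≤ k → k < l → ¬ p ≤ pos k)) →
             ∃ λ q → p ≤ q × q + length w ≤ p + (B + B) × OccursAt u w q
    locate p (l , _ , _ , above , h) with inf (u l)
    ... | v , v′ , e = pos l + length v , ≤-trans above (m≤m+n _ _) ,
        end (near p l h) (bound (u l)) (trans (cong length e) (trans (length-++ v) (cong (length v +_) (length-++ w)))) ,
        proj₁ (occ-++⁻ w v′ (proj₂ (occ-++⁻ v (w ++ v′) o)))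
      where
      o : OccursAt u (v ++ w ++ v′) (pos l)
      o = subst (λ x → OccursAt u x (pos l)) (trans (⋆-letter θ (u l)) e) (image-occ fix (occ-letter l))
      end : ∀ {a b} → a ≤ p + B → b ≤ B → b ≡ length v + (length w + length v′) →
          (a + length v) + length w ≤ p + (B + B)
      end {a} {b} x y z = lin (x ⊕ y ⊕ ≡⇒≥ z)
          (≤-solve (a ∷ length v ∷ length w ∷ p ∷ B ∷ b ∷ length v′ ∷ [])
          λ a |v| |w| p B b |v′| → a ⊞ |v| ⊞ |w| ⊞ (p ⊞ B ⊞ (B ⊞ b)) ≼
          p ⊞ (B ⊞ B) ⊞ (a ⊞ (b ⊞ (|v| ⊞ (|w| ⊞ |v′|)))))

module Primitivity {n : ℕ} (φ : Morphism n) (u : InfWord n) (acyc : Acyclic φ) (k : ℕ)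
  (prim : ∀ a b → b ∈ fold (a ∷ []) (φ ⋆_) k) (fp : FixedPoint φ u) where
  open Windows u
  open Images u

  -- Over one letter every morphism is cyclic, so there are two distinct letters, and primitivity
  -- puts both into each image.
  pow-≥2 : ∀ a → 2 ≤ length (pow φ k a)
  pow-≥2 a = let (x , y , ne) = distinct-letters φ u acyc in two-letters ne (prim a x) (prim a y)

  pow-erased : ∀ {a} → φ a ≡ [] → ∀ m → pow φ (suc m) a ≡ []
  pow-erased {a} e zero = trans (⋆-letter φ a) e
  pow-erased e (suc m) = cong (φ ⋆_) (pow-erased e m)

  nonerasing : ∀ a → 1 ≤ length (φ a)
  nonerasing a with φ a in eq
  ... | _ ∷ _ = s≤s z≤n
  ... | [] = ⊥-elim (go k pow-≥2)
    where
    go : ∀ k → (∀ a → 2 ≤ length (pow φ k a)) → ⊥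
    go zero h = lin⊥ (h a) ≤-refl
    go (suc k) h = lin⊥ (h a ⊕ ≡⇒≤ (cong length (pow-erased eq k)))
        (≤-solve (length (pow φ (suc k) a) ∷ []) λ l → lit 1 ⊞ (l ⊞ lit 0) ≼ lit 1 ⊞ (lit 1 ⊞ l))

  pow-nonerasing : ∀ m a → 1 ≤ length (pow φ m a)
  pow-nonerasing zero a = ≤-refl
  pow-nonerasing (suc m) a = ≤-trans (pow-nonerasing m a) (length-⋆-≥ nonerasing (pow φ m a))

  pow-growth : ∀ j a → suc j ≤ length (pow φ (j * k) a)
  pow-growth zero a = ≤-refl
  pow-growth (suc j) a =
      combine (pow-growth j a) (length-⋆ pow-≥2 (pow φ (j * k) a)) (cong length (pow-+ φ k (j * k) a))
    where
    combine : ∀ {a b c} → suc j ≤ a → a * 2 ≤ b → c ≡ b → suc (suc j) ≤ c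
    combine {a} {b} p q refl = lin (p ⊕ p ⊕ q ⊕ ≡⇒≤ (*-comm 2 a))
        (≤-solve (j ∷ a ∷ b ∷ a * 2 ∷ []) λ j a b 2a → lit 1 ⊞ (lit 1 ⊞ (j ⊞ (a ⊞ (a ⊞ (b ⊞ 2a))))) ≼
        b ⊞ (lit 1 ⊞ (j ⊞ (lit 1 ⊞ (j ⊞ (2a ⊞ (a ⊞ (a ⊞ lit 0))))))))

  -- The word `θ (u 0)` is a prefix of u longer than `m`, so it contains `w`. Since `u 0` occurs in
  -- every image under the `k`-th power, `θ (u 0)` occurs in every image under the power
  -- `m * k + k`.
  uniformlyRecurrent : UniformlyRecurrent u
  uniformlyRecurrent w (i , o) =
      occ-in-image (fixes-pow (fixed-prefix fp) (m * k + k)) (pow-nonerasing (m * k + k)) w inf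
    where
    m : ℕ
    m = i + length w
    θ : Morphism n
    θ = pow φ (m * k)
    fix : Fixes θ
    fix = fixes-pow (fixed-prefix fp) (m * k)
    start : OccursAt u (θ (u 0)) 0
    start = subst (λ x → OccursAt u x 0) (⋆-letter θ (u 0)) (image-occ fix (occ-letter 0))
    in-start : Infix w (θ (u 0))
    in-start =
        subst (Infix w) start (NewPalindromes.infix-win⁺ u z≤n (≤-trans (n≤1+n m) (pow-growth m (u 0))) o)
    inf : ∀ b → Infix w (pow φ (m * k + k) b)
    inf b = subst (Infix w) (sym (pow-+ φ (m * k) k b)) (infix-trans in-start
      (subst (λ x → Infix x (θ ⋆ pow φ k b)) (⋆-letter θ (u 0)) (infix-⋆ θ (letter-infix (prim b (u 0))))))

-- Conjugate morphisms and the lifting of factors.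

module _ {n : ℕ} where

  record Conjugates (α β : Morphism n) (R : Word n) : Set where
    constructor conjugates
    field conj-letter : ∀ a → α a ++ R ≡ R ++ β a

  open Conjugates

  conj-⋆ : ∀ {α β R} → Conjugates α β R → ∀ w → α ⋆ w ++ R ≡ R ++ β ⋆ w
  conj-⋆ {R = R} h [] = sym (++-identityʳ R)
  conj-⋆ {α} {β} {R} h (a ∷ w) = begin
    (α a ++ α ⋆ w) ++ R   ≡⟨ ++-assoc (α a) (α ⋆ w) R ⟩
    α a ++ α ⋆ w ++ R     ≡⟨ cong (α a ++_) (conj-⋆ h w) ⟩
    α a ++ R ++ β ⋆ w     ≡⟨ sym (++-assoc (α a) R (β ⋆ w)) ⟩
    (α a ++ R) ++ β ⋆ w   ≡⟨ cong (_++ β ⋆ w) (conj-letter h a) ⟩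
    (R ++ β a) ++ β ⋆ w   ≡⟨ ++-assoc R (β a) (β ⋆ w) ⟩
    R ++ β a ++ β ⋆ w     ∎
    where open ≡-Reasoning

  conj-⊙ : ∀ {α β R α′ β′ R′} → Conjugates α β R → Conjugates α′ β′ R′ →
      Conjugates (α ⊙ α′) (β ⊙ β′) (α ⋆ R′ ++ R)
  conj-⊙ {α} {β} {R} {α′} {β′} {R′} h h′ = conjugates λ a → begin
    α ⋆ α′ a ++ α ⋆ R′ ++ R      ≡⟨ sym (++-assoc (α ⋆ α′ a) (α ⋆ R′) R) ⟩
    (α ⋆ α′ a ++ α ⋆ R′) ++ R    ≡⟨ cong (_++ R) (sym (⋆-++ α (α′ a) R′)) ⟩
    α ⋆ (α′ a ++ R′) ++ R        ≡⟨ cong (λ w → α ⋆ w ++ R) (conj-letter h′ a) ⟩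
    α ⋆ (R′ ++ β′ a) ++ R        ≡⟨ cong (_++ R) (⋆-++ α R′ (β′ a)) ⟩
    (α ⋆ R′ ++ α ⋆ β′ a) ++ R    ≡⟨ ++-assoc (α ⋆ R′) (α ⋆ β′ a) R ⟩
    α ⋆ R′ ++ α ⋆ β′ a ++ R      ≡⟨ cong (α ⋆ R′ ++_) (conj-⋆ h (β′ a)) ⟩
    α ⋆ R′ ++ R ++ β ⋆ β′ a      ≡⟨ sym (++-assoc (α ⋆ R′) R (β ⋆ β′ a)) ⟩
    (α ⋆ R′ ++ R) ++ β ⋆ β′ a    ∎
    where open ≡-Reasoning

  conj-trans : ∀ {α β γ R R′} → Conjugates α β R → Conjugates β γ R′ → Conjugates α γ (R ++ R′)
  conj-trans {α} {β} {γ} {R} {R′} h h′ = conjugates λ a → begin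
    α a ++ R ++ R′     ≡⟨ sym (++-assoc (α a) R R′) ⟩
    (α a ++ R) ++ R′   ≡⟨ cong (_++ R′) (conj-letter h a) ⟩
    (R ++ β a) ++ R′   ≡⟨ ++-assoc R (β a) R′ ⟩
    R ++ β a ++ R′     ≡⟨ cong (R ++_) (conj-letter h′ a) ⟩
    R ++ R′ ++ γ a     ≡⟨ sym (++-assoc R R′ (γ a)) ⟩
    (R ++ R′) ++ γ a   ∎
    where open ≡-Reasoning

  conj-length : ∀ {α β R} → Conjugates α β R → ∀ a → length (α a) ≡ length (β a)
  conj-length {α} {β} {R} h a =
      lin≡ (trans (sym (length-++ (α a))) (trans (cong length (conj-letter h a)) (length-++ R)))
      (≡-solve (length (α a) ∷ length R ∷ length (β a) ∷ []) λ x r y → x ⊞ (r ⊞ y) ≼ y ⊞ (x ⊞ r))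

  longer-prefix : ∀ {x y s t : Word n} → x ++ s ≡ y ++ t → length x ≤ length y → ∃ λ r → y ≡ x ++ r
  longer-prefix {x} {y} e le with prefix-compare x y e
  ... | inj₁ p = p
  ... | inj₂ ([] , refl) = [] , sym (trans (++-identityʳ (y ++ [])) (++-identityʳ y))
  ... | inj₂ (b ∷ r , refl) = ⊥-elim (lin⊥ (le ⊕ ≡⇒≥ (length-++ y {b ∷ r}))
      (≤-solve (length y ∷ length (y ++ b ∷ r) ∷ length r ∷ []) λ |y| |ybr| |r| → lit 1 ⊞ (|y| ⊞ |ybr|) ≼
      |ybr| ⊞ (|y| ⊞ (lit 1 ⊞ |r|))))

  -- By length α(v) = Rt for some t, and cancelling R in RtR = α(v)R = Rβ(v) leaves β(v) = tR.
  conj-suffix : ∀ {α β R} → Conjugates α β R → ∀ v → length R ≤ length (α ⋆ v) → ∃ λ t → β ⋆ v ≡ t ++ R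
  conj-suffix {α} {β} {R} h v le with longer-prefix {R} {α ⋆ v} (sym (conj-⋆ h v)) le
  ... | t , e = t , ++-cancelˡ R _ _ (trans (sym (conj-⋆ h v)) (trans (cong (_++ R) e) (++-assoc R t R)))

  conj-prefix : ∀ {α β R} → Conjugates α β R → ∀ v → length R ≤ length (α ⋆ v) → ∃ λ t → α ⋆ v ≡ R ++ t
  conj-prefix h v le = longer-prefix (sym (conj-⋆ h v)) le

  reverse-⋆ : ∀ (α : Morphism n) w → reverse (α ⋆ w) ≡ (λ a → reverse (α a)) ⋆ reverse w
  reverse-⋆ α [] = refl
  reverse-⋆ α (a ∷ w) = begin
    reverse (α a ++ α ⋆ w)                ≡⟨ reverse-++ (α a) (α ⋆ w) ⟩
    reverse (α ⋆ w) ++ reverse (α a)      ≡⟨ cong₂ _++_ (reverse-⋆ α w) (sym (⋆-letter α~ a)) ⟩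
    α~ ⋆ reverse w ++ α~ ⋆ (a ∷ [])       ≡⟨ sym (⋆-++ α~ (reverse w) (a ∷ [])) ⟩
    α~ ⋆ (reverse w ++ a ∷ [])            ≡⟨ cong (α~ ⋆_) (sym (unfold-reverse a w)) ⟩
    α~ ⋆ reverse (a ∷ w)                  ∎
    where
    open ≡-Reasoning
    α~ : Morphism n
    α~ a = reverse (α a)

  -- The first letter of the common image is the first letter of both words; the images of this
  -- letter have equal length, so they can be cancelled.
  marked-injective : ∀ {β γ : Morphism n} → (∀ a → ∃ λ t → β a ≡ a ∷ t) → (∀ a → ∃ λ t → γ a ≡ a ∷ t) →
                     (∀ a → length (β a) ≡ length (γ a)) → ∀ v w → β ⋆ v ≡ γ ⋆ w → v ≡ w
  marked-injective fβ fγ len [] [] e = refl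
  marked-injective {β} {γ} fβ fγ len [] (b ∷ w) e with fγ b
  ... | t , eq with () ← trans e (cong (_++ γ ⋆ w) eq)
  marked-injective {β} {γ} fβ fγ len (a ∷ v) [] e with fβ a
  ... | t , eq with () ← trans (sym e) (cong (_++ β ⋆ v) eq)
  marked-injective {β} {γ} fβ fγ len (a ∷ v) (b ∷ w) e =
    heads (∷-injectiveˡ (trans (sym (cong (_++ β ⋆ v) (proj₂ (fβ a)))) (trans e (cong (_++ γ ⋆ w) (proj₂ (fγ b))))))
    where
    heads : a ≡ b → a ∷ v ≡ b ∷ w
    heads refl = cong (a ∷_) (marked-injective fβ fγ len v w (proj₂ (++-injective (β a) (γ a) (len a) e)))

  -- For a power `θ` of φ, `α` and `β` are the corresponding powers of φ_R and φ_L. `W` links `α` to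
  -- `θ`, which gives their images equal lengths.
  record Lift (u : InfWord n) (θ : Morphism n) : Set where
    field
      α β    : Morphism n
      R W    : Word n
      f g    : Fin n → Fin n
      conj   : Conjugates α β R
      conjθ  : Conjugates α θ W
      β-first : ∀ a → ∃ λ t → β a ≡ f a ∷ t
      α-last  : ∀ a → ∃ λ t → α a ≡ t ∷ʳ g a
      factor  : ∀ w → IsFactor u w → IsFactor u (α ⋆ w ++ R)

    lift : Word n → Word n
    lift w = α ⋆ w ++ R

  open Lift

  lift-id : ∀ {u φ} → Lift u (pow φ 0)
  lift-id {u} {φ} = record
    { α = pow φ 0 ; β = pow φ 0 ; R = [] ; W = [] ; f = λ a → a ; g = λ a → a
    ; conj = conjugates λ a → refl ; conjθ = conjugates λ a → refl
    ; β-first = λ a → [] , refl ; α-last = λ a → [] , refl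
    ; factor = λ w → subst (IsFactor u) (sym (trans (++-identityʳ _) (concatMap-pure w))) }

  lift-⊙ : ∀ {u θ θ′} → Lift u θ → Lift u θ′ → Lift u (θ ⊙ θ′)
  lift-⊙ {u} s s′ = record
    { α = α s ⊙ α s′ ; β = β s ⊙ β s′ ; R = α s ⋆ R s′ ++ R s ; W = α s ⋆ W s′ ++ W s
    ; f = λ a → f s (f s′ a) ; g = λ a → g s (g s′ a)
    ; conj = conj-⊙ (conj s) (conj s′) ; conjθ = conj-⊙ (conjθ s) (conjθ s′)
    ; β-first = λ a → let (t′ , e′) = β-first s′ a ; (t , e) = β-first s (f s′ a) in
        t ++ β s ⋆ t′ , trans (cong (β s ⋆_) e′) (cong (_++ β s ⋆ t′) e)
    ; α-last = λ a → let (t′ , e′) = α-last s′ a ; (t , e) = α-last s (g s′ a) in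
        α s ⋆ t′ ++ t , trans (cong (α s ⋆_) e′) (trans (⋆-++ (α s) t′ (g s′ a ∷ []))
          (trans (cong (α s ⋆ t′ ++_) (trans (⋆-letter (α s) (g s′ a)) e)) (sym (++-assoc (α s ⋆ t′) t _))))
    ; factor = λ w fw → subst (IsFactor u) (begin
        α s ⋆ (α s′ ⋆ w ++ R s′) ++ R s            ≡⟨ cong (_++ R s) (⋆-++ (α s) (α s′ ⋆ w) (R s′)) ⟩
        (α s ⋆ (α s′ ⋆ w) ++ α s ⋆ R s′) ++ R s    ≡⟨ ++-assoc (α s ⋆ (α s′ ⋆ w)) (α s ⋆ R s′) (R s) ⟩
        α s ⋆ (α s′ ⋆ w) ++ α s ⋆ R s′ ++ R s      ≡⟨ cong (_++ α s ⋆ R s′ ++ R s) (sym (⊙-⋆ (α s) (α s′) w)) ⟩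
        (α s ⊙ α s′) ⋆ w ++ α s ⋆ R s′ ++ R s      ∎) (factor s _ (factor s′ w fw)) }
    where open ≡-Reasoning

  lift-pow : ∀ {u φ} → Lift u φ → ∀ k → Lift u (pow φ k)
  lift-pow {φ = φ} s zero = lift-id {φ = φ}
  lift-pow s (suc k) = lift-⊙ s (lift-pow s k)

  lift-pow-f : ∀ {u φ} (s : Lift u φ) k a → f (lift-pow s k) a ≡ fold a (f s) k
  lift-pow-f s zero a = refl
  lift-pow-f s (suc k) a = cong (f s) (lift-pow-f s k a)

  lift-pow-g : ∀ {u φ} (s : Lift u φ) k a → g (lift-pow s k) a ≡ fold a (g s) k
  lift-pow-g s zero a = refl
  lift-pow-g s (suc k) a = cong (g s) (lift-pow-g s k a)

  lift-pow-R : ∀ {u φ} (s : Lift u φ) k → R s ≢ [] → R (lift-pow s (suc k)) ≢ []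
  lift-pow-R s k ne e = ne (++-conicalʳ (α s ⋆ R (lift-pow s k)) (R s) e)

module FixingLift {n : ℕ} {u : InfWord n} {θ : Morphism n} (s : Lift u θ)
  (f-id : ∀ a → Lift.f s a ≡ a) (g-id : ∀ a → Lift.g s a ≡ a) (θ≥2 : ∀ a → 2 ≤ length (θ a)) where
  open Lift s
  open Images u

  private
    first′ : ∀ a → ∃ λ t → β a ≡ a ∷ t
    first′ a = let (t , e) = β-first a in t , trans e (cong (_∷ t) (f-id a))
    last′ : ∀ a → ∃ λ t → α a ≡ t ∷ʳ a
    last′ a = let (t , e) = α-last a in t , trans e (cong (t ∷ʳ_) (g-id a))

  -- Moving `R` across the last image gives α(y w y′)R = α(y) · α(w)R · β(y′), where α(y) ends in y
  -- and β(y′) begins with y′.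
  lift-extension : ∀ {y w y′} → IsFactor u (y ∷ w ∷ʳ y′) → IsFactor u (y ∷ lift w ∷ʳ y′)
  lift-extension {y} {w} {y′} fw = factor-infix (proj₁ (last′ y) , proj₁ (first′ y′) , eq) (factor _ fw)
    where
    open ≡-Reasoning
    eq : lift (y ∷ w ∷ʳ y′) ≡ proj₁ (last′ y) ++ (y ∷ lift w ∷ʳ y′) ++ proj₁ (first′ y′)
    eq = begin
      (α y ++ α ⋆ (w ∷ʳ y′)) ++ R                     ≡⟨ cong (λ x → (α y ++ x) ++ R) (⋆-++ α w (y′ ∷ [])) ⟩
      (α y ++ α ⋆ w ++ α ⋆ (y′ ∷ [])) ++ R            ≡⟨ ++-assoc (α y) (α ⋆ w ++ α ⋆ (y′ ∷ [])) R ⟩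
      α y ++ (α ⋆ w ++ α ⋆ (y′ ∷ [])) ++ R            ≡⟨ cong (α y ++_) (++-assoc (α ⋆ w) _ R) ⟩
      α y ++ α ⋆ w ++ α ⋆ (y′ ∷ []) ++ R              ≡⟨ cong (λ x → α y ++ α ⋆ w ++ x) (conj-⋆ conj (y′ ∷ [])) ⟩
      α y ++ α ⋆ w ++ R ++ β ⋆ (y′ ∷ [])              ≡⟨ cong (λ x → α y ++ α ⋆ w ++ R ++ x) (trans (⋆-letter β y′) (proj₂ (first′ y′))) ⟩
      α y ++ α ⋆ w ++ R ++ y′ ∷ t′                    ≡⟨ cong (α y ++_) (sym (++-assoc (α ⋆ w) R (y′ ∷ t′))) ⟩
      α y ++ lift w ++ y′ ∷ t′                        ≡⟨ cong₂ _++_ (proj₂ (last′ y)) (sym (++-assoc (lift w) (y′ ∷ []) t′)) ⟩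
      (t ∷ʳ y) ++ (lift w ∷ʳ y′) ++ t′                ≡⟨ ++-assoc t (y ∷ []) ((lift w ∷ʳ y′) ++ t′) ⟩
      t ++ (y ∷ lift w ∷ʳ y′) ++ t′                   ∎
      where
      t t′ : Word n
      t = proj₁ (last′ y)
      t′ = proj₁ (first′ y′)

  -- With R cancelled, β(z) equals the mirror image of α(z); since β and the mirrored α map each
  -- letter a to words of equal length beginning with a, this forces z = reverse z.
  lift-palindrome⁻ : ∀ {z} → Palindrome (lift z) → Palindrome z
  lift-palindrome⁻ {z} p = marked-injective first′
      (λ a → let (t , e) = last′ a in reverse t , trans (cong reverse e) (reverse-++ t (a ∷ [])))
      (λ a → trans (sym (conj-length conj a)) (sym (length-reverse (α a))))
      z (reverse z) (trans (proj₂ (++-injective R (reverse R) (sym (length-reverse R)) eq)) (reverse-⋆ α z))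
    where
    eq : R ++ β ⋆ z ≡ reverse R ++ reverse (α ⋆ z)
    eq = trans (sym (conj-⋆ conj z)) (trans p (reverse-++ (α ⋆ z) R))

  lift-length : ∀ z → z ≢ [] ⊎ R ≢ [] → suc (length z) ≤ length (lift z)
  lift-length z c = grows c (length-⋆ {φ = α} α≥2 z) (length-++ (α ⋆ z) {R})
    where
    α≥2 : ∀ a → 2 ≤ length (α a)
    α≥2 a = ≤-trans (θ≥2 a) (≤-reflexive (sym (conj-length conjθ a)))
    positive : ∀ w → w ≢ [] → 1 ≤ length {A = Fin n} w
    positive [] ne = ⊥-elim (ne refl)
    positive (_ ∷ _) _ = s≤s z≤n
    grows : ∀ {a b} → z ≢ [] ⊎ R ≢ [] → length z * 2 ≤ a → b ≡ a + length R → suc (length z) ≤ b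
    grows {a} {b} (inj₁ ne) x e = lin (x ⊕ ≡⇒≥ e ⊕ positive z ne ⊕ ≡⇒≤ (*-comm 2 (length z)))
        (≤-solve (length z ∷ a ∷ b ∷ length z * 2 ∷ length R ∷ [])
        λ |z| a b 2z |R| → lit 1 ⊞ (|z| ⊞ (a ⊞ (b ⊞ (|z| ⊞ 2z)))) ≼
        b ⊞ (2z ⊞ (a ⊞ |R| ⊞ (lit 1 ⊞ (|z| ⊞ (|z| ⊞ lit 0))))))
    grows {a} {b} (inj₂ ne) x e = lin (x ⊕ ≡⇒≥ e ⊕ positive R ne ⊕ ≡⇒≤ (*-comm 2 (length z)))
        (≤-solve (length z ∷ a ∷ b ∷ length R ∷ length z * 2 ∷ [])
        λ |z| a b |R| 2z → lit 1 ⊞ (|z| ⊞ (a ⊞ (b ⊞ (|R| ⊞ 2z)))) ≼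
        b ⊞ (2z ⊞ (a ⊞ |R| ⊞ (lit 1 ⊞ (|z| ⊞ (|z| ⊞ lit 0))))))

  record LongLift (z : Word n) (N : ℕ) : Set where
    field
      word        : Word n
      long        : N ≤ length word
      extension   : ∀ {y y′} → IsFactor u (y ∷ z ∷ʳ y′) → IsFactor u (y ∷ word ∷ʳ y′)
      palindrome⁻ : Palindrome word → Palindrome z

  -- Each lift adds at least one letter. After the first lift the word is nonempty, so the
  -- alternative `R ≢ []` serves only for the empty z.
  longLift : ∀ N z → z ≢ [] ⊎ R ≢ [] → LongLift z (N + length z)
  longLift zero z _ = record { word = z ; long = ≤-refl ; extension = λ x → x ; palindrome⁻ = λ p → p }
  longLift (suc N) z c with longLift N (lift z) (inj₁ λ e → lin⊥ (lift-length z c ⊕ ≡⇒≤ (cong length e))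
      (≤-solve (length (lift z) ∷ length z ∷ []) λ |liftz| |z| → lit 1 ⊞ (|liftz| ⊞ lit 0) ≼
      lit 1 ⊞ (|z| ⊞ |liftz|)))
  ... | l = record
    { word = word ; long = lin (long ⊕ lift-length z c)
        (≤-solve (N ∷ length z ∷ length word ∷ length (lift z) ∷ [])
        λ N |z| |word| |liftz| → lit 1 ⊞ (N ⊞ |z|) ⊞ (|word| ⊞ |liftz|) ≼
        |word| ⊞ (N ⊞ |liftz| ⊞ (lit 1 ⊞ |z|)))
    ; extension = λ x → extension (lift-extension x) ; palindrome⁻ = λ p → lift-palindrome⁻ (palindrome⁻ p) }
    where open LongLift l

-- A common period for a permutation of the letters.

module _ {A : Set} where

  fold-+ : ∀ (f : A → A) k l a → fold a f (k + l) ≡ fold (fold a f l) f k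
  fold-+ f zero l a = refl
  fold-+ f (suc k) l a = cong f (fold-+ f k l a)

  fold-period : ∀ (f : A → A) {p a} → fold a f p ≡ a → ∀ c → fold a f (c * p) ≡ a
  fold-period f h zero = refl
  fold-period f {p} {a} h (suc c) =
      trans (fold-+ f p (c * p) a) (trans (cong (λ x → fold x f p) (fold-period f h c)) h)

  fold-cancel : ∀ (f : A → A) → Injective _≡_ _≡_ f → ∀ k l a → fold a f k ≡ fold a f (k + l) → fold a f l ≡ a
  fold-cancel f inj zero l a e = sym e
  fold-cancel f inj (suc k) l a e = fold-cancel f inj k l a (inj e)

common-multiple : ∀ {k} (p : Fin k → ℕ) → (∀ a → 1 ≤ p a) → ∃ λ m → 1 ≤ m × (∀ a → ∃ λ c → m ≡ c * p a)
common-multiple {zero} p h = 1 , ≤-refl , λ ()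
common-multiple {suc k} p h with common-multiple (λ a → p (Fin.suc a)) (λ a → h (Fin.suc a))
... | m , 1≤m , d = p Fin.zero * m , *-mono-≤ (h Fin.zero) 1≤m , λ
  { Fin.zero → m , *-comm (p Fin.zero) m
  ; (Fin.suc a) → let (c , e) = d a in p Fin.zero * c , trans (cong (p Fin.zero *_) e) (sym (*-assoc (p Fin.zero) c (p (Fin.suc a)))) }

letter-period : ∀ {n} (f : Fin n → Fin n) → Injective _≡_ _≡_ f → ∀ a → ∃ λ p → 1 ≤ p × fold a f p ≡ a
letter-period {n} f inj a with pigeonhole (n<1+n n) (λ i → fold a f (toℕ i))
... | i , j , i<j , e with m≤n⇒∃[o]m+o≡n i<j
... | d , eq = suc d , s≤s z≤n ,
  fold-cancel f inj (toℕ i) (suc d) a (trans e (cong (fold a f) (trans (sym eq) (sym (+-suc (toℕ i) d)))))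

permutation-order : ∀ {n} (f : Fin n → Fin n) → Injective _≡_ _≡_ f → ∃ λ m → 1 ≤ m × (∀ a → fold a f m ≡ a)
permutation-order f inj =
  let period = letter-period f inj
      (m , 1≤m , c) = common-multiple (λ a → proj₁ (period a)) (λ a → proj₁ (proj₂ (period a)))
  in m , 1≤m , λ a → trans (cong (fold a f) (proj₂ (c a))) (fold-period f (proj₂ (proj₂ (period a))) (proj₁ (c a)))

-- Transfer of acyclicity from a lift back to the original word.

module _ {n : ℕ} where

  -- An additive quantity invariant under reversal and injective on letters: comparing it on both
  -- sides of y w = w̃ c cancels w and leaves y = c.
  weight : Word n → ℕ
  weight [] = 0
  weight (a ∷ w) = toℕ a + weight w

  weight-∷ʳ : ∀ w a → weight (w ∷ʳ a) ≡ weight w + toℕ a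
  weight-∷ʳ [] a = +-identityʳ (toℕ a)
  weight-∷ʳ (b ∷ w) a = trans (cong (toℕ b +_) (weight-∷ʳ w a)) (sym (+-assoc (toℕ b) (weight w) (toℕ a)))

  weight-reverse : ∀ w → weight (reverse w) ≡ weight w
  weight-reverse [] = refl
  weight-reverse (a ∷ w) = trans (cong weight (unfold-reverse a w)) (trans (weight-∷ʳ (reverse w) a)
    (trans (cong (_+ toℕ a) (weight-reverse w)) (+-comm (weight w) (toℕ a))))

  rotated-letter : ∀ {y c : Fin n} w → y ∷ w ≡ reverse w ∷ʳ c → y ≡ c
  rotated-letter {y} {c} w e = toℕ-injective (+-cancelʳ-≡ (weight w) (toℕ y) (toℕ c) (begin
    weight (y ∷ w)           ≡⟨ cong weight e ⟩
    weight (reverse w ∷ʳ c)  ≡⟨ weight-∷ʳ (reverse w) c ⟩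
    weight (reverse w) + toℕ c ≡⟨ cong (_+ toℕ c) (weight-reverse w) ⟩
    weight w + toℕ c         ≡⟨ +-comm (weight w) (toℕ c) ⟩
    toℕ c + weight w         ∎))
    where open ≡-Reasoning

  -- The equation w y = c w forces w to be a power of the letter c.
  commuting-letter : ∀ {y c : Fin n} w → w ∷ʳ y ≡ c ∷ w → y ≡ c × Palindrome w
  commuting-letter [] refl = refl , refl
  commuting-letter {y} {c} (d ∷ w) e with ∷-injective e
  ... | refl , e′ with commuting-letter w e′
  ... | refl , p = refl , sym (trans (unfold-reverse d w) (trans (cong (_∷ʳ d) (sym p)) e′))

letter : ∀ {n} → Vertex n → Fin n
letter (left y) = y
letter (right y) = y

module Transfer {n : ℕ} (u : InfWord n) (rc : ReversalClosed u)
  (z Z : Word n) (extension : ∀ {y y′} → IsFactor u (y ∷ z ∷ʳ y′) → IsFactor u (y ∷ Z ∷ʳ y′))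
  (palindrome⁻ : Palindrome Z → Palindrome z) where
  open ExtensionGraph u

  pal-extension : ∀ {c} → Palindrome z → z ∷ʳ c ≡ reverse (c ∷ z)
  pal-extension {c} p = trans (cong (_∷ʳ c) p) (sym (unfold-reverse c z))

  -- A coincidence over `Z` forces y = c, and for a right vertex also that `Z` is a palindrome. Then
  -- z is a palindrome as well, and the coincidence is already present over z.
  avoids-lift : ∀ {c} v → Avoids (c ∷ z) (ext z v) → Avoids (c ∷ Z) (ext Z v)
  avoids-lift {c} (left y) (h , _) = (λ e → h (cong (_∷ z) (∷-injectiveˡ e))) ,
    λ e → h (cong (_∷ z) (rotated-letter Z (trans e (unfold-reverse c Z))))
  avoids-lift {c} (right y) (_ , h) = (λ e → let (e′ , p) = commuting-letter Z e in bad e′ p) ,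
    λ e → let (p , e′) = ∷ʳ-injective Z (reverse Z) (trans e (unfold-reverse c Z)) in bad e′ p
    where
    bad : y ≡ c → Palindrome Z → ⊥
    bad refl p = h (pal-extension (palindrome⁻ p))

  adjacent-lift : (Palindrome z → Palindrome Z) → ∀ {v v′} → Adjacent z v v′ → Adjacent Z v v′
  adjacent-lift h (edge f) = edge (extension f)
  adjacent-lift h (edgeᵒ f) = edgeᵒ (extension f)
  adjacent-lift h (flip p) = flip (h p)
  adjacent-lift h (flipᵒ p) = flipᵒ (h p)

  path-lift : (Palindrome z → Palindrome Z) → ∀ {c v v′} → Path z (c ∷ z) v v′ → Path Z (c ∷ Z) v v′
  path-lift h = gmap (λ v → v) (λ {v} {v′} (a , a′ , s) → avoids-lift v a , avoids-lift v′ a′ , adjacent-lift h s)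

  -- If z is a palindrome but Z is not, the extension graph of Z contains the bipartite double
  -- cover of that of z; a path lifts twice, either keeping or exchanging the two sheets.
  module Cover (p : Palindrome z) (c : Fin n) where

    avoids-letter : ∀ v → Avoids (c ∷ z) (ext z v) → letter v ≢ c
    avoids-letter (left y) (h , _) refl = h refl
    avoids-letter (right y) (_ , h) refl = h (pal-extension p)

    avoids-ext : ∀ v → letter v ≢ c → Avoids (c ∷ Z) (ext Z v)
    avoids-ext (left y) ne =
        (λ e → ne (∷-injectiveˡ e)) , λ e → ne (rotated-letter Z (trans e (unfold-reverse c Z)))
    avoids-ext (right y) ne = (λ e → ne (proj₁ (commuting-letter Z e))) ,
      λ e → ne (proj₂ (∷ʳ-injective Z (reverse Z) (trans e (unfold-reverse c Z))))

    swap : ∀ {y y′} → IsFactor u (y ∷ z ∷ʳ y′) → IsFactor u (y′ ∷ z ∷ʳ y)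
    swap {y} {y′} f = subst (IsFactor u) (trans (unfold-reverse y (z ∷ʳ y′)) (cong (_∷ʳ y)
      (trans (reverse-++ z (y′ ∷ [])) (cong (y′ ∷_) (sym p))))) (rc _ f)

    Doubled : Fin n → Fin n → Set
    Doubled x y = (Path Z (c ∷ Z) (right x) (right y) × Path Z (c ∷ Z) (left x) (left y))
                ⊎ (Path Z (c ∷ Z) (right x) (left y) × Path Z (c ∷ Z) (left x) (right y))

    cross : ∀ {x y} → x ≢ c → y ≢ c → IsFactor u (x ∷ z ∷ʳ y) →
            Path Z (c ∷ Z) (right x) (left y) × Path Z (c ∷ Z) (left x) (right y)
    cross {x} {y} nx ny f =
      (avoids-ext (right x) nx , avoids-ext (left y) ny , edgeᵒ (extension (swap f))) ◅ ε ,
      (avoids-ext (left x) nx , avoids-ext (right y) ny , edge (extension f)) ◅ ε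

    _⨟_ : ∀ {x y t} → Doubled x y → Doubled y t → Doubled x t
    inj₁ (a , b) ⨟ inj₁ (a′ , b′) = inj₁ (a ◅◅ a′ , b ◅◅ b′)
    inj₁ (a , b) ⨟ inj₂ (a′ , b′) = inj₂ (a ◅◅ a′ , b ◅◅ b′)
    inj₂ (a , b) ⨟ inj₁ (a′ , b′) = inj₂ (a ◅◅ b′ , b ◅◅ a′)
    inj₂ (a , b) ⨟ inj₂ (a′ , b′) = inj₁ (a ◅◅ b′ , b ◅◅ a′)

    double : ∀ {v v′} → Path z (c ∷ z) v v′ → Doubled (letter v) (letter v′)
    double ε = inj₁ (ε , ε)
    double ((a , a′ , edge {y} {y′} f) ◅ π) =
        inj₂ (cross (avoids-letter (left y) a) (avoids-letter (right y′) a′) f) ⨟ double π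
    double ((a , a′ , edgeᵒ {y} {y′} f) ◅ π) =
        inj₂ (cross (avoids-letter (right y′) a) (avoids-letter (left y) a′) (swap f)) ⨟ double π
    double ((_ , _ , flip _) ◅ π) = double π
    double ((_ , _ , flipᵒ _) ◅ π) = double π

    close : ¬ Palindrome Z → ∀ {a b} → a ≢ c → b ≢ c → IsFactor u (c ∷ z ∷ʳ a) → IsFactor u (c ∷ z ∷ʳ b) →
            Doubled a b → Path Z (c ∷ Z) (right a) (right b)
    close np na nb fa fb (inj₁ (π , _)) = π
    -- When the sheets are exchanged, the two lifted paths are joined through `right c`: from
    -- `right a` to `left b`, `right c`, `left a` and `right b`. As `Z` is not a palindrome,
    -- `right c` stands neither for `c ∷ Z` nor for its mirror image.
    close np {a} {b} na nb fa fb (inj₂ (π , ρ)) = π ◅◅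
      ((avoids-ext (left b) nb , avoids-c , edge (extension (swap fb))) ◅
       (avoids-c , avoids-ext (left a) na , edgeᵒ (extension (swap fa))) ◅ ρ)
      where
      avoids-c : Avoids (c ∷ Z) (Z ∷ʳ c)
      avoids-c = (λ e → np (proj₂ (commuting-letter Z e))) ,
        λ e → np (proj₁ (∷ʳ-injective Z (reverse Z) (trans e (unfold-reverse c Z))))

  acyclicAt-transfer : AcyclicAt u Z → AcyclicAt u z
  acyclicAt-transfer acyc c a b av av′ fa fb π with palindrome? Z | palindrome? z
  ... | yes p | _ =
      acyc c a b (avoids-lift (right a) av) (avoids-lift (right b) av′) (extension fa) (extension fb) (path-lift (λ _ → p) π)
  ... | no _ | no np =
      acyc c a b (avoids-lift (right a) av) (avoids-lift (right b) av′) (extension fa) (extension fb) (path-lift (λ p → ⊥-elim (np p)) π)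
  ... | no np | yes p =
      acyc c a b (avoids-lift (right a) av) (avoids-lift (right b) av′) (extension fa) (extension fb)
      (close np (avoids-letter (right a) av) (avoids-letter (right b) av′) fa fb (double π))
    where open Cover p c

-- The lift given by the leftmost and rightmost conjugates.

module Base {n : ℕ} {φ : Morphism n} {u : InfWord n} (nonerasing : ∀ a → 1 ≤ length (φ a))
  (ur : UniformlyRecurrent u) (fp : FixedPoint φ u) {φL φR : Morphism n} {w₁ w₂ : Word n}
  (conjL : Conjugates φ φL w₁) (conjR : Conjugates φR φ w₂)
  (injL : Injective _≡_ _≡_ (Fst φL)) (injR : Injective _≡_ _≡_ (Lst φR)) where
  open Windows u
  open Images u

  last-∷ʳ : ∀ (w : Word n) a → last (w ∷ʳ a) ≡ just a
  last-∷ʳ [] a = refl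
  last-∷ʳ (_ ∷ []) a = refl
  last-∷ʳ (_ ∷ w@(_ ∷ _)) a = last-∷ʳ w a

  first-letter : ∀ a → ∃ λ b → ∃ λ t → φL a ≡ b ∷ t
  first-letter a with φL a | ≤-trans (nonerasing a) (≤-reflexive (conj-length conjL a))
  ... | b ∷ t | _ = b , t , refl

  last-letter : ∀ a → ∃ λ b → ∃ λ t → φR a ≡ t ∷ʳ b
  last-letter a with φR a | ≤-trans (nonerasing a) (≤-reflexive (sym (conj-length conjR a)))
  ... | w | le with initLast w
  ... | t ∷ʳ′ b = b , t , refl
  last-letter a | .[] | () | []

  first-injective : Injective _≡_ _≡_ (λ a → proj₁ (first-letter a))
  first-injective {a} {b} e = injL (trans (cong head (proj₂ (proj₂ (first-letter a))))
    (trans (cong just e) (sym (cong head (proj₂ (proj₂ (first-letter b)))))))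

  last-injective : Injective _≡_ _≡_ (λ a → proj₁ (last-letter a))
  last-injective {a} {b} e = injR (trans (lst a) (trans (cong just e) (sym (lst b))))
    where
    lst : ∀ a → Lst φR a ≡ just (proj₁ (last-letter a))
    lst a = trans (cong last (proj₂ (proj₂ (last-letter a)))) (last-∷ʳ (proj₁ (proj₂ (last-letter a))) _)

  -- φR(w) w₂ w₁ = w₂ φ(w) w₁, and a long left (right) context of w has an image ending in w₂
  -- (beginning with w₁).
  image-factor : ∀ w → IsFactor u w → IsFactor u (φR ⋆ w ++ w₂ ++ w₁)
  image-factor w f with ur w f
  ... | G , rec with rec (length w₂)
  ... | q , a , _ , o with conj-suffix conjR v (enough φR v (conj-lengths conjR) (≤-trans a (≤-reflexive (sym (length-win 0 q)))))
    where
    v : Word n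
    v = u [ 0 , q ]
    conj-lengths : ∀ {α β R} → Conjugates α β R → ∀ a → length (β a) ≡ length (α a)
    conj-lengths h a = sym (conj-length h a)
    enough : ∀ (α : Morphism n) v {m} →
        (∀ a → length (φ a) ≡ length (α a)) → m ≤ length v → m ≤ length (α ⋆ v)
    enough α v e le = ≤-trans le (length-⋆-≥ (λ a → ≤-trans (nonerasing a) (≤-reflexive (e a))) v)
  ... | t , e with conj-prefix conjL (u [ q + length w , length w₁ ])
                     (≤-trans (≤-reflexive (sym (length-win (q + length w) (length w₁)))) (length-⋆-≥ {φ =
                         φ} nonerasing (u [ q + length w , length w₁ ])))
  ... | t′ , e′ = factor-infix (t , t′ , eq) (_ , image-occ (fixed-prefix fp) whole)
    where
    open ≡-Reasoning
    v v′ : Word n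
    v = u [ 0 , q ]
    v′ = u [ q + length w , length w₁ ]
    at : ∀ {x : Word n} {i j} → i ≡ j → OccursAt u x i → OccursAt u x j
    at refl o = o
    whole : OccursAt u (v ++ w ++ v′) 0
    whole =
        occ-++⁺ v (w ++ v′) (occ-win 0 q) (at (sym (length-win 0 q)) (occ-++⁺ w v′ o (occ-win (q + length w) (length w₁))))
    eq : φ ⋆ (v ++ w ++ v′) ≡ t ++ (φR ⋆ w ++ w₂ ++ w₁) ++ t′
    eq = begin
      φ ⋆ (v ++ w ++ v′)                       ≡⟨ ⋆-++ φ v (w ++ v′) ⟩
      φ ⋆ v ++ φ ⋆ (w ++ v′)                   ≡⟨ cong₂ _++_ e (trans (⋆-++ φ w v′) (cong (φ ⋆ w ++_) e′)) ⟩
      (t ++ w₂) ++ φ ⋆ w ++ w₁ ++ t′           ≡⟨ ++-assoc t w₂ _ ⟩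
      t ++ w₂ ++ φ ⋆ w ++ w₁ ++ t′             ≡⟨ cong (t ++_) (sym (++-assoc w₂ (φ ⋆ w) (w₁ ++ t′))) ⟩
      t ++ (w₂ ++ φ ⋆ w) ++ w₁ ++ t′           ≡⟨ cong (λ x → t ++ x ++ w₁ ++ t′) (sym (conj-⋆ conjR w)) ⟩
      t ++ (φR ⋆ w ++ w₂) ++ w₁ ++ t′          ≡⟨ cong (t ++_) (sym (++-assoc (φR ⋆ w ++ w₂) w₁ t′)) ⟩
      t ++ ((φR ⋆ w ++ w₂) ++ w₁) ++ t′        ≡⟨ cong (λ x → t ++ x ++ t′) (++-assoc (φR ⋆ w) w₂ w₁) ⟩
      t ++ (φR ⋆ w ++ w₂ ++ w₁) ++ t′          ∎

  lift₀ : Lift u φ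
  lift₀ = record
    { α = φR ; β = φL ; R = w₂ ++ w₁ ; W = w₂
    ; f = λ a → proj₁ (first-letter a) ; g = λ a → proj₁ (last-letter a)
    ; conj = conj-trans conjR conjL ; conjθ = conjR
    ; β-first = λ a → proj₂ (first-letter a) ; α-last = λ a → proj₂ (last-letter a)
    ; factor = image-factor }

  conj-nil : ∀ {α β : Morphism n} → Conjugates α β [] → ∀ a → α a ≡ β a
  conj-nil h a = trans (sym (++-identityʳ _)) (Conjugates.conj-letter h a)

  -- If the word were empty, φ would equal both φ_L and φ_R. Conjugation by a nonempty word gives
  -- all images under φ the same first or the same last letter, and conjugation by the empty word
  -- returns φ itself.
  conj-nontrivial : ¬ Constant (Fst φL) → ¬ Constant (Lst φR) → HasDistinctConjugate φ → w₂ ++ w₁ ≢ []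
  conj-nontrivial ncL ncR (ψ , inj₁ ([] , h) , ne) e = ne (λ a → sym (trans (sym (++-identityʳ _)) (h a)))
  conj-nontrivial ncL ncR (ψ , inj₁ (c ∷ w , h) , ne) e = ncL (λ a b → trans (fst a) (sym (fst b)))
    where
    same : ∀ a → φ a ≡ φL a
    same = conj-nil (subst (Conjugates φ φL) (++-conicalʳ w₂ w₁ e) conjL)
    head-++ : ∀ (x : Word n) {y} → 1 ≤ length x → head (x ++ y) ≡ head x
    head-++ (_ ∷ _) _ = refl
    fst : ∀ a → Fst φL a ≡ just c
    fst a = trans (cong head (sym (same a))) (trans (sym (head-++ (φ a) (nonerasing a))) (cong head (h a)))
  conj-nontrivial ncL ncR (ψ , inj₂ (w , h) , ne) e with initLast w
  ... | [] = ne (λ a → trans (sym (++-identityʳ _)) (h a))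
  ... | w′ ∷ʳ′ c = ncR (λ a b → trans (lst a) (sym (lst b)))
    where
    same : ∀ a → φR a ≡ φ a
    same = conj-nil (subst (Conjugates φR φ) (++-conicalˡ w₂ w₁ e) conjR)
    last-++ : ∀ (x y : Word n) → 1 ≤ length y → last (x ++ y) ≡ last y
    last-++ [] y le = refl
    last-++ (_ ∷ []) (_ ∷ _) le = refl
    last-++ (_ ∷ x@(_ ∷ _)) y le = last-++ x y le
    lst : ∀ a → Lst φR a ≡ just c
    lst a = trans (cong last (same a)) (trans (sym (last-++ (w′ ∷ʳ c) (φ a) (nonerasing a)))
      (trans (cong last (sym (h a))) (trans (cong last (sym (++-assoc (ψ a) w′ (c ∷ [])))) (last-∷ʳ (ψ a ++ w′) c))))

-- From integer defects to palindrome counts, and the conclusion.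

letterReturns : ∀ {n} (u : InfWord n) → LetterReturnsPalindromic u → ∀ c → Windows.PalReturns u (c ∷ [])
letterReturns u h c i j ret = subst (PalSegment i) end (palSegment⁺ i _ (h c _
    (i , j , i<j , occ start , occ (MirrorReturn.end ret) , (λ k a b o → inner k a b (inj₁ o)) , refl)))
  where
  open Windows u
  open MirrorReturn ret using (i<j; start; inner)
  occ : ∀ {k} → MirrorOcc (c ∷ []) k → OccursAt u (c ∷ []) k
  occ (inj₁ o) = o
  occ (inj₂ o) = o
  end : i + ((j ∸ i) + 1) ≡ j + 1
  end = lin≡ (m+[n∸m]≡n (<⇒≤ i<j))
      (≡-solve (i ∷ (j ∸ i) ∷ j ∷ []) λ i δ j → i ⊞ (δ ⊞ lit 1) ⊞ j ≼ j ⊞ lit 1 ⊞ (i ⊞ δ))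

difference-≤⇒ : ∀ a p {s} → ℤ.+ a ℤ.- ℤ.+ p ℤ.≤ s → a ≤ p + ℤ.∣ s ∣
difference-≤⇒ a p {s} h with ≤-total a p
... | inj₁ a≤p = ≤-trans a≤p (m≤m+n p ℤ.∣ s ∣)
... | inj₂ p≤a =
    ≤-trans (m≤n+m∸n a p) (+-monoʳ-≤ p (bound (subst (ℤ._≤ s) (trans (ℤ.m-n≡m⊖n a p) (ℤ.⊖-≥ p≤a)) h)))
  where
  bound : ∀ {m s} → ℤ.+ m ℤ.≤ s → m ≤ ℤ.∣ s ∣
  bound (ℤ.+≤+ h) = h

module _ {n : ℕ} where

  count-bound : ∀ (w : Word n) {s} → D w ℤ.≤ s → suc (length w) ≤ palCount w + ℤ.∣ s ∣
  count-bound w {s} h = subst (λ p → suc (length w) ≤ p + ℤ.∣ s ∣) (sym (palCount-def w))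
    (difference-≤⇒ (suc (length w)) (length (palindromicFactors w)) h)

  defect-bound : ∀ (w : Word n) → suc (length w) ≤ palCount w → D w ℤ.≤ ℤ.+ 0
  defect-bound w h = ℤ.i≤j⇒i-j≤0 (ℤ.+≤+ (subst (suc (length w) ≤_) (palCount-def w) h))

-- The periods of the first and of the last letters and the exponent of primitivity are combined
-- into one power of φ, whose images have length at least two and whose lift fixes all letters.
module Main {n : ℕ} (φ : Morphism n) (u : InfWord n) (acyc : Acyclic φ) (k : ℕ)
  (prim : ∀ a b → b ∈ fold (a ∷ []) (φ ⋆_) k) (fp : FixedPoint φ u) {φL φR : Morphism n} {w₁ w₂ : Word n}
  (conjL : Conjugates φ φL w₁) (conjR : Conjugates φR φ w₂)
  (ncL : ¬ Constant (Fst φL)) (ncR : ¬ Constant (Lst φR))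
  (injL : Injective _≡_ _≡_ (Fst φL)) (injR : Injective _≡_ _≡_ (Lst φR))
  (hyp : LetterReturnsPalindromic u ⊎ HasDistinctConjugate φ) where

  open Primitivity φ u acyc k prim fp
  open Base nonerasing uniformlyRecurrent fp conjL conjR injL injR

  private
    order-f : ∃ λ m → 1 ≤ m × (∀ a → fold a (Lift.f lift₀) m ≡ a)
    order-f = permutation-order (Lift.f lift₀) first-injective
    order-g : ∃ λ m → 1 ≤ m × (∀ a → fold a (Lift.g lift₀) m ≡ a)
    order-g = permutation-order (Lift.g lift₀) last-injective
    mf mg M : ℕ
    mf = proj₁ order-f
    mg = proj₁ order-g
    M = mf * mg
    1≤M : 1 ≤ M
    1≤M = *-mono-≤ (proj₁ (proj₂ order-f)) (proj₁ (proj₂ order-g))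

    e : ℕ
    e = M * k
    S : Lift u (pow φ e)
    S = lift-pow lift₀ e

    e-f : e ≡ (mg * k) * mf
    e-f = trans (*-assoc mf mg k) (*-comm mf (mg * k))
    e-g : e ≡ (mf * k) * mg
    e-g = trans (cong (_* k) (*-comm mf mg)) (trans (*-assoc mg mf k) (*-comm mg (mf * k)))
    f-id : ∀ a → Lift.f S a ≡ a
    f-id a = trans (lift-pow-f lift₀ e a) (trans (cong (fold a (Lift.f lift₀)) e-f)
      (fold-period (Lift.f lift₀) (proj₂ (proj₂ order-f) a) (mg * k)))
    g-id : ∀ a → Lift.g S a ≡ a
    g-id a = trans (lift-pow-g lift₀ e a) (trans (cong (fold a (Lift.g lift₀)) e-g)
      (fold-period (Lift.g lift₀) (proj₂ (proj₂ order-g) a) (mf * k)))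
    θ≥2 : ∀ a → 2 ≤ length (pow φ e a)
    θ≥2 a = ≤-trans (s≤s 1≤M) (pow-growth M a)
    open FixingLift S f-id g-id θ≥2

    R-nontrivial : HasDistinctConjugate φ → Lift.R S ≢ []
    -- The zeroth power has an empty `R`, so the exponent must be positive; `k` is positive because
    -- the zeroth power has images of length one.
    R-nontrivial h = positive e (≤-trans 1≤M (m≤m*n M k {{>-nonZero k≥1}}))
      where
      positive-exponent : ∀ k → (∀ a → 2 ≤ length (pow φ k a)) → 1 ≤ k
      positive-exponent zero h = ⊥-elim (lin⊥ (h (u 0)) ≤-refl)
      positive-exponent (suc _) _ = s≤s z≤n
      k≥1 : 1 ≤ k
      k≥1 = positive-exponent k pow-≥2
      positive : ∀ e → 1 ≤ e → Lift.R (lift-pow lift₀ e) ≢ []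
      positive (suc e) _ = lift-pow-R lift₀ e (conj-nontrivial ncL ncR h)

  module _ (closed : ReversalClosed u) {N : ℕ} (new : EventuallyNew u N) where

    acyclicAt-lifted : ∀ {z} → LongLift z (N + length z) → AcyclicAt u z
    acyclicAt-lifted {z} l = Transfer.acyclicAt-transfer u closed z word extension palindrome⁻
      (λ c a b → Acyclic.acyclic u uniformlyRecurrent closed word (λ V len → long-palReturns u new V (enough long len)) c)
      where
      open LongLift l
      enough : ∀ {m v} → N + length z ≤ m → v ≡ suc m → N ≤ v
      enough {m} {v} p q = lin (p ⊕ ≡⇒≥ q)
          (≤-solve (N ∷ m ∷ v ∷ length z ∷ []) λ N m v |z| → N ⊞ (m ⊞ v) ≼ v ⊞ (N ⊞ |z| ⊞ (lit 1 ⊞ m)))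

    acyclicAt : ∀ z → z ≢ [] ⊎ Lift.R S ≢ [] → AcyclicAt u z
    acyclicAt z c = acyclicAt-lifted (longLift N z c)

    rich : ∀ w → IsFactor u w → suc (length w) ≤ palCount w
    rich = Rich.factor-rich u (Returns.palReturns u closed (λ z ne → acyclicAt z (inj₁ ne))
      ([ (λ h → inj₂ (letterReturns u h)) , (λ h → inj₁ (acyclicAt [] (inj₂ (R-nontrivial h)))) ]′ hyp))

  maxDefect-rich : MaxDefect u → ∀ w → IsFactor u w → suc (length w) ≤ palCount w
  maxDefect-rich md = let (N , new) = eventuallyNew u uniformlyRecurrent md in
    rich (reversal-closed u uniformlyRecurrent new) new

  result : FiniteDefect u → DefectIs u (ℤ.+ 0)
  result (s , b) = (λ w f → defect-bound w (decidable-stable (suc (length w) ≤? palCount w)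
      (λ ¬r → maxDefect u ℤ.∣ s ∣ (λ w f → count-bound w (b w f)) (λ md → ¬r (maxDefect-rich md w f)))))
    -- The empty factor has defect 0, so no bound lies below 0.
    , λ t bt → bt [] (0 , refl)

open import Data.Integer.Base using (+_)

theorem1 : (n : ℕ) (φ : Morphism n) (u : InfWord n) →
    Primitive φ → Marked φ → FixedPoint φ u → FiniteDefect u →
    LetterReturnsPalindromic u ⊎ HasDistinctConjugate φ →
    DefectIs u (+ 0)
theorem1 n φ u (k , prim) (acyc , (φL , ((w₁ , hL) , ncL) , injL) , (φR , ((w₂ , hR) , ncR) , injR)) fp fd hyp =
  Main.result φ u acyc k prim fp (conjugates hL) (conjugates hR) ncL ncR injL injR hyp fd
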